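{- Under $\mathrm{GBC}^{ -f}+\mathrm{IE}$, there is no nontrivial $\Sigma_1$-elementary embedding $j\colon V\to V$ of the universe to itself.
   Context: $\mathrm{GBC}^{ -f}$ is Gödel–Bernays set theory with global choice but without foundation. Two sets $x,y$ are isomorphic if there is an isomorphism of $\langle\mathrm{TC}(\{x\}),\in\rangle$ with $\langle\mathrm{TC}(\{y\}),\in\rangle$ mapping $x$ to $y$ ($\mathrm{TC}$ = transitive closure). $\mathrm{IE}$ (isomorphism extensionality) is the axiom: isomorphic sets are equal. $\Sigma_1$-elementarity refers to the language $\{\in\}$ with parameters. -}

module Defs where

open import Data.Nat using (ℕ; zero; suc)
open import Data.Product using (Σ; ∃; ∃-syntax; _×_; _,_)
open import Data.Sum using (_⊎_)
open import Data.Empty using (⊥)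
open import Relation.Nullary using (¬_)
open import Relation.Binary.PropositionalEquality using (_≡_)
open import Function.Bundles using (_⇔_)

-- Two-sorted structures for the language of Gödel–Bernays set theory:
-- a sort of sets S, a sort of classes C, membership of sets in sets and
-- of sets in classes.  Equality of sets is interpreted as ≡ (normal models).

record Structure : Set₁ where
  field
    S     : Set
    C     : Set
    _∈_   : S → S → Set
    _∈ᶜ_  : S → C → Set

-- Syntax of (two-sorted) first-order formulas, de Bruijn indices.
-- Set variables and class variables live in separate index spaces.

data Fm : Set where
  mem   : ℕ → ℕ → Fm
  memᶜ  : ℕ → ℕ → Fm
  eq    : ℕ → ℕ → Fm
  falsum : Fm
  _∧f_ _∨f_ _⇒f_ : Fm → Fm → Fm
  ∀s ∃s : Fm → Fm
  ∀c ∃c : Fm → Fm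

ext : {A : Set} → A → (ℕ → A) → ℕ → A
ext a ρ zero    = a
ext a ρ (suc n) = ρ n

module _ (M : Structure) where
  open Structure M

  Sat : Fm → (ℕ → S) → (ℕ → C) → Set
  Sat (mem i j)  ρ σ = ρ i ∈ ρ j
  Sat (memᶜ i k) ρ σ = ρ i ∈ᶜ σ k
  Sat (eq i j)   ρ σ = ρ i ≡ ρ j
  Sat falsum     ρ σ = ⊥
  Sat (φ ∧f ψ)   ρ σ = Sat φ ρ σ × Sat ψ ρ σ
  Sat (φ ∨f ψ)   ρ σ = Sat φ ρ σ ⊎ Sat ψ ρ σ
  Sat (φ ⇒f ψ)   ρ σ = Sat φ ρ σ → Sat ψ ρ σ
  Sat (∀s φ)     ρ σ = (a : S) → Sat φ (ext a ρ) σ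
  Sat (∃s φ)     ρ σ = Σ S λ a → Sat φ (ext a ρ) σ
  Sat (∀c φ)     ρ σ = (X : C) → Sat φ ρ (ext X σ)
  Sat (∃c φ)     ρ σ = Σ C λ X → Sat φ ρ (ext X σ)

data Predicative : Fm → Set where
  p-mem  : ∀ i j → Predicative (mem i j)
  p-memᶜ : ∀ i k → Predicative (memᶜ i k)
  p-eq   : ∀ i j → Predicative (eq i j)
  p-⊥    : Predicative falsum
  p-∧    : ∀ {φ ψ} → Predicative φ → Predicative ψ → Predicative (φ ∧f ψ)
  p-∨    : ∀ {φ ψ} → Predicative φ → Predicative ψ → Predicative (φ ∨f ψ)
  p-⇒    : ∀ {φ ψ} → Predicative φ → Predicative ψ → Predicative (φ ⇒f ψ)
  p-∀    : ∀ {φ} → Predicative φ → Predicative (∀s φ)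
  p-∃    : ∀ {φ} → Predicative φ → Predicative (∃s φ)

data Δ₀ : Fm → Set where
  d-mem : ∀ i j → Δ₀ (mem i j)
  d-eq  : ∀ i j → Δ₀ (eq i j)
  d-⊥   : Δ₀ falsum
  d-∧   : ∀ {φ ψ} → Δ₀ φ → Δ₀ ψ → Δ₀ (φ ∧f ψ)
  d-∨   : ∀ {φ ψ} → Δ₀ φ → Δ₀ ψ → Δ₀ (φ ∨f ψ)
  d-⇒   : ∀ {φ ψ} → Δ₀ φ → Δ₀ ψ → Δ₀ (φ ⇒f ψ)
  d-∀∈  : ∀ {φ} y → Δ₀ φ → Δ₀ (∀s (mem 0 (suc y) ⇒f φ))
  d-∃∈  : ∀ {φ} y → Δ₀ φ → Δ₀ (∃s (mem 0 (suc y) ∧f φ))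

data Σ₁ : Fm → Set where
  s-Δ₀ : ∀ {φ} → Δ₀ φ → Σ₁ φ
  s-∃  : ∀ {φ} → Σ₁ φ → Σ₁ (∃s φ)

module Notions (M : Structure) where
  open Structure M

  _⊆_ : S → S → Set
  x ⊆ y = ∀ z → z ∈ x → z ∈ y

  IsEmpty : S → Set
  IsEmpty e = ∀ z → ¬ (z ∈ e)

  IsPair : S → S → S → Set
  IsPair p x y = ∀ z → (z ∈ p) ⇔ (z ≡ x ⊎ z ≡ y)

  IsSingleton : S → S → Set
  IsSingleton s x = IsPair s x x

  IsOPair : S → S → S → Set
  IsOPair p x y = ∃[ s ] ∃[ t ] (IsSingleton s x × IsPair t x y × IsPair p s t)

  IsUnion : S → S → Set
  IsUnion u x = ∀ z → (z ∈ u) ⇔ (∃[ w ] (w ∈ x × z ∈ w))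

  IsPower : S → S → Set
  IsPower p x = ∀ z → (z ∈ p) ⇔ (z ⊆ x)

  IsSucc : S → S → Set
  IsSucc s x = ∀ z → (z ∈ s) ⇔ (z ∈ x ⊎ z ≡ x)

  RelC : C → S → S → Set
  RelC F x y = ∃[ p ] (IsOPair p x y × p ∈ᶜ F)

  RelS : S → S → S → Set
  RelS f x y = ∃[ p ] (IsOPair p x y × p ∈ f)

  Transitive : S → Set
  Transitive t = ∀ z w → w ∈ t → z ∈ w → z ∈ t

  IsTC : S → S → Set
  IsTC t a = a ⊆ t × Transitive t × (∀ t' → Transitive t' → a ⊆ t' → t ⊆ t')

  IsTCsingleton : S → S → Set
  IsTCsingleton t x = ∃[ s ] (IsSingleton s x × IsTC t s)

  IsIso : S → S → S → Set
  IsIso f t u =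
      (∀ p → p ∈ f → ∃[ a ] ∃[ b ] (IsOPair p a b × a ∈ t × b ∈ u))
    × (∀ a → a ∈ t → ∃[ b ] RelS f a b)
    × (∀ a b b' → RelS f a b → RelS f a b' → b ≡ b')
    × (∀ a a' b → RelS f a b → RelS f a' b → a ≡ a')
    × (∀ b → b ∈ u → ∃[ a ] RelS f a b)
    × (∀ a a' b b' → RelS f a b → RelS f a' b' → (a ∈ a') ⇔ (b ∈ b'))

  Isomorphic : S → S → Set
  Isomorphic x y = ∃[ t ] ∃[ u ] ∃[ f ]
    (IsTCsingleton t x × IsTCsingleton u y × IsIso f t u × RelS f x y)

record GBC⁻ᶠ (M : Structure) : Set₁ where
  open Structure M
  open Notions M
  field
    extensionality      : ∀ x y → (∀ z → (z ∈ x) ⇔ (z ∈ y)) → x ≡ y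
    class-extensionality : ∀ (X Y : C) → (∀ z → (z ∈ᶜ X) ⇔ (z ∈ᶜ Y)) → X ≡ Y
    emptyset            : ∃[ e ] IsEmpty e
    pairing             : ∀ x y → ∃[ p ] IsPair p x y
    union               : ∀ x → ∃[ u ] IsUnion u x
    powerset            : ∀ x → ∃[ p ] IsPower p x
    infinity            : ∃[ I ] ((∃[ e ] (IsEmpty e × e ∈ I))
                                  × (∀ x → x ∈ I → ∃[ s ] (IsSucc s x × s ∈ I)))
    separation          : ∀ (X : C) a → ∃[ b ] (∀ z → (z ∈ b) ⇔ (z ∈ a × z ∈ᶜ X))
    replacement         : ∀ (F : C) a
                          → (∀ x → x ∈ a → ∃[ y ] (RelC F x y × (∀ y' → RelC F x y' → y' ≡ y)))
                          → ∃[ b ] (∀ y → (y ∈ b) ⇔ (∃[ x ] (x ∈ a × RelC F x y)))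
    comprehension       : ∀ φ → Predicative φ → ∀ (ρ : ℕ → S) (σ : ℕ → C)
                          → ∃[ X ] (∀ z → (z ∈ᶜ X) ⇔ Sat M φ (ext z ρ) σ)
    global-choice       : ∃[ G ] (∀ x → (∃[ z ] (z ∈ x))
                            → ∃[ y ] (y ∈ x × RelC G x y × (∀ y' → RelC G x y' → y' ≡ y)))

IE : Structure → Set
IE M = ∀ x y → Isomorphic x y → x ≡ y
  where open Structure M
        open Notions M

record NontrivialΣ₁Embedding (M : Structure) (J : Structure.C M) : Set where
  open Structure M
  open Notions M
  field
    total       : ∀ x → ∃[ y ] RelC J x y
    functional  : ∀ x y y' → RelC J x y → RelC J x y' → y ≡ y'
    elementary  : ∀ φ → Σ₁ φ → ∀ (ρ ρ' : ℕ → S) (σ : ℕ → C)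
                  → (∀ n → RelC J (ρ n) (ρ' n))
                  → Sat M φ ρ σ ⇔ Sat M φ ρ' σ
    nontrivial  : ∃[ x ] ∃[ y ] (RelC J x y × ¬ (x ≡ y))

{-# OPTIONS --safe #-}
module Submission where

open import Defs
open import Level using (0ℓ)
open import Axiom.ExcludedMiddle using (ExcludedMiddle)
open import Data.Empty using (⊥; ⊥-elim)
open import Data.List using (List; []; _∷_)
open import Data.Nat using (ℕ; suc; _+_)
open import Data.Product using (∃-syntax; _×_; _,_; proj₁; proj₂)
open import Data.Sum using (_⊎_; inj₁; inj₂; [_,_]′)
open import Function using (id; _∘_; case_of_)
open import Function.Bundles using (_⇔_; mk⇔; Equivalence)
open import Function.Construct.Composition using (_⇔-∘_)
open import Function.Construct.Symmetry using (⇔-sym)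
open import Relation.Binary.PropositionalEquality
  using (_≡_; refl; sym; trans; cong; subst; subst₂)
open import Relation.Nullary using (¬_; yes; no)

open Equivalence using (to; from)

-- Fix a set x.  Iterating y ↦ y ∪ ⋃y ∪ j(y) from {x} gives a transitive set Z
-- with x ∈ Z and j(Z) ⊆ Z.  The core is that j(Z) = j[Z].  Let F choose a
-- representative of each class of sequences in Z modulo eventual equality; by an
-- argument of Galvin and Prikry there is A ⊆ Z of the size of Z such that every
-- B ⊆ A of the size of Z satisfies A ⊆ {F(s)(n) : s ∈ B^ω, n ∈ ω}.  Apply j to
-- this and take B = j[A]: it is of the size of j(Z) because j(Z) ⊆ Z embeds in A.
-- Since j fixes ω pointwise, a sequence in j[A] is j(s) for some s, and
-- j(F)(j(s))(n) = j(F(s)(n)); so j(A) ⊆ j[Z], whence j(Z) = j[Z].  Thus j restricts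
-- to an isomorphism of TC({x}) with j(TC({x})) = TC({j(x)}), and IE gives x = j(x).

-- Formulas paired with the predicates they define.

data Π₁ : Fm → Set where
  π-Δ₀ : ∀ {φ} → Δ₀ φ → Π₁ φ
  π-∀  : ∀ {φ} → Π₁ φ → Π₁ (∀s φ)

Δ₀⇒Predicative : ∀ {φ} → Δ₀ φ → Predicative φ
Δ₀⇒Predicative (d-mem i j) = p-mem i j
Δ₀⇒Predicative (d-eq i j)  = p-eq i j
Δ₀⇒Predicative d-⊥         = p-⊥
Δ₀⇒Predicative (d-∧ d d′)  = p-∧ (Δ₀⇒Predicative d) (Δ₀⇒Predicative d′)
Δ₀⇒Predicative (d-∨ d d′)  = p-∨ (Δ₀⇒Predicative d) (Δ₀⇒Predicative d′)
Δ₀⇒Predicative (d-⇒ d d′)  = p-⇒ (Δ₀⇒Predicative d) (Δ₀⇒Predicative d′)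
Δ₀⇒Predicative (d-∀∈ y d)  = p-∀ (p-⇒ (p-mem _ _) (Δ₀⇒Predicative d))
Δ₀⇒Predicative (d-∃∈ y d)  = p-∃ (p-∧ (p-mem _ _) (Δ₀⇒Predicative d))

module Definability (M : Structure) where
  open Structure M

  _▸ : {Γ : Set} → (Γ → ℕ → S) → (Γ × S → ℕ → S)
  (e ▸) p = ext (proj₂ p) (e (proj₁ p))

  -- With e known, the combinators below infer P from the variable numbers.
  record Def (K : Fm → Set) (σ : ℕ → C) {Γ : Set} (e : Γ → ℕ → S)
             (P : Γ → Set) : Set where
    constructor def
    field
      fm  : Fm
      ok  : K fm
      sat : ∀ γ → Sat M fm (e γ) σ ⇔ P γ

  module _ {σ : ℕ → C} {Γ : Set} {e : Γ → ℕ → S} where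

    conv : ∀ {K} {P Q : Γ → Set} → (∀ γ → P γ ⇔ Q γ) → Def K σ e P → Def K σ e Q
    conv h (def f k s) = def f k λ γ → h γ ⇔-∘ s γ

    ⌜_⌝ : {P : Γ → Set} → Def Δ₀ σ e P → Def Predicative σ e P
    ⌜ def f k s ⌝ = def f (Δ₀⇒Predicative k) s

    ΔΠ : {P : Γ → Set} → Def Δ₀ σ e P → Def Π₁ σ e P
    ΔΠ (def f k s) = def f (π-Δ₀ k) s

    private
      variable
        P Q : Γ → Set
        R : Γ → S → Set

      and : ∀ {A A′ B B′ : Set} → A ⇔ A′ → B ⇔ B′ → (A × B) ⇔ (A′ × B′)
      and a b = mk⇔ (λ (x , y) → to a x , to b y) (λ (x , y) → from a x , from b y)

      or : ∀ {A A′ B B′ : Set} → A ⇔ A′ → B ⇔ B′ → (A ⊎ B) ⇔ (A′ ⊎ B′)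
      or a b = mk⇔ [ inj₁ ∘ to a , inj₂ ∘ to b ]′ [ inj₁ ∘ from a , inj₂ ∘ from b ]′

      imp : ∀ {A A′ B B′ : Set} → A ⇔ A′ → B ⇔ B′ → (A → B) ⇔ (A′ → B′)
      imp a b = mk⇔ (λ f → to b ∘ f ∘ from a) (λ f → from b ∘ f ∘ to a)

      all : {A B : S → Set} → (∀ a → A a ⇔ B a) → (∀ a → A a) ⇔ (∀ a → B a)
      all h = mk⇔ (λ f a → to (h a) (f a)) (λ f a → from (h a) (f a))

      some : {A B : S → Set} → (∀ a → A a ⇔ B a) → (∃[ a ] A a) ⇔ (∃[ a ] B a)
      some h = mk⇔ (λ (a , p) → a , to (h a) p) (λ (a , p) → a , from (h a) p)

      ⇔-refl : {A : Set} → A ⇔ A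
      ⇔-refl = mk⇔ id id

    infixr 4 _∧ᵈ_ _∧ᵖ_
    infixr 3 _∨ᵈ_ _∨ᵖ_
    infixr 2 _⇒ᵈ_ _⇒ᵖ_

    memᵈ : ∀ i k → Def Δ₀ σ e (λ γ → e γ i ∈ e γ k)
    memᵈ i k = def (mem i k) (d-mem i k) λ _ → ⇔-refl

    eqᵈ : ∀ i k → Def Δ₀ σ e (λ γ → e γ i ≡ e γ k)
    eqᵈ i k = def (eq i k) (d-eq i k) λ _ → ⇔-refl

    ⊥ᵈ : Def Δ₀ σ e (λ _ → ⊥)
    ⊥ᵈ = def falsum d-⊥ λ _ → ⇔-refl

    _∧ᵈ_ : Def Δ₀ σ e P → Def Δ₀ σ e Q → Def Δ₀ σ e (λ γ → P γ × Q γ)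
    def _ k s ∧ᵈ def _ l t = def _ (d-∧ k l) λ γ → and (s γ) (t γ)

    _∨ᵈ_ : Def Δ₀ σ e P → Def Δ₀ σ e Q → Def Δ₀ σ e (λ γ → P γ ⊎ Q γ)
    def _ k s ∨ᵈ def _ l t = def _ (d-∨ k l) λ γ → or (s γ) (t γ)

    _⇒ᵈ_ : Def Δ₀ σ e P → Def Δ₀ σ e Q → Def Δ₀ σ e (λ γ → P γ → Q γ)
    def _ k s ⇒ᵈ def _ l t = def _ (d-⇒ k l) λ γ → imp (s γ) (t γ)

    ∀∈ᵈ : ∀ k → Def Δ₀ σ (e ▸) (λ p → R (proj₁ p) (proj₂ p))
        → Def Δ₀ σ e (λ γ → ∀ a → a ∈ e γ k → R γ a)
    ∀∈ᵈ k (def _ l t) = def _ (d-∀∈ k l) λ γ → all λ a → imp ⇔-refl (t (γ , a))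

    ∃∈ᵈ : ∀ k → Def Δ₀ σ (e ▸) (λ p → R (proj₁ p) (proj₂ p))
        → Def Δ₀ σ e (λ γ → ∃[ a ] (a ∈ e γ k × R γ a))
    ∃∈ᵈ k (def _ l t) = def _ (d-∃∈ k l) λ γ → some λ a → and ⇔-refl (t (γ , a))

    ∀ᵖⁱ : Def Π₁ σ (e ▸) (λ p → R (proj₁ p) (proj₂ p))
        → Def Π₁ σ e (λ γ → ∀ a → R γ a)
    ∀ᵖⁱ (def _ l t) = def _ (π-∀ l) λ γ → all λ a → t (γ , a)

    memᶜᵖ : ∀ i k → Def Predicative σ e (λ γ → e γ i ∈ᶜ σ k)
    memᶜᵖ i k = def (memᶜ i k) (p-memᶜ i k) λ _ → ⇔-refl

    _∧ᵖ_ : Def Predicative σ e P → Def Predicative σ e Q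
         → Def Predicative σ e (λ γ → P γ × Q γ)
    def _ k s ∧ᵖ def _ l t = def _ (p-∧ k l) λ γ → and (s γ) (t γ)

    _∨ᵖ_ : Def Predicative σ e P → Def Predicative σ e Q
         → Def Predicative σ e (λ γ → P γ ⊎ Q γ)
    def _ k s ∨ᵖ def _ l t = def _ (p-∨ k l) λ γ → or (s γ) (t γ)

    _⇒ᵖ_ : Def Predicative σ e P → Def Predicative σ e Q
         → Def Predicative σ e (λ γ → P γ → Q γ)
    def _ k s ⇒ᵖ def _ l t = def _ (p-⇒ k l) λ γ → imp (s γ) (t γ)

    ¬ᵖ_ : Def Predicative σ e P → Def Predicative σ e (λ γ → ¬ P γ)
    ¬ᵖ d = d ⇒ᵖ ⌜ ⊥ᵈ ⌝

    ∀ᵖ : Def Predicative σ (e ▸) (λ p → R (proj₁ p) (proj₂ p))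
       → Def Predicative σ e (λ γ → ∀ a → R γ a)
    ∀ᵖ (def _ l t) = def _ (p-∀ l) λ γ → all λ a → t (γ , a)

    ∃ᵖ : Def Predicative σ (e ▸) (λ p → R (proj₁ p) (proj₂ p))
       → Def Predicative σ e (λ γ → ∃[ a ] R γ a)
    ∃ᵖ (def _ l t) = def _ (p-∃ l) λ γ → some λ a → t (γ , a)

-- Pairs, unions, products and relations, with their defining formulas.

module SetTheory (em : ExcludedMiddle 0ℓ) (M : Structure) (gbc : GBC⁻ᶠ M) where
  open Structure M public
  open Notions M public
  open GBC⁻ᶠ gbc public
  open Definability M public

  ⊆-antisym : ∀ {x y} → x ⊆ y → y ⊆ x → x ≡ y
  ⊆-antisym p q = extensionality _ _ λ z → mk⇔ (p z) (q z)

  abstract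
    ∅ : S
    ∅ = proj₁ emptyset

    ∅-empty : IsEmpty ∅
    ∅-empty = proj₂ emptyset

  env : List S → ℕ → S
  env []      = λ _ → ∅
  env (a ∷ l) = ext a (env l)

  abstract
    pr : S → S → S
    pr x y = proj₁ (pairing x y)

    pr-⇔ : ∀ {x y z} → z ∈ pr x y ⇔ (z ≡ x ⊎ z ≡ y)
    pr-⇔ {x} {y} = proj₂ (pairing x y) _

  ∈prˡ : ∀ {x y} → x ∈ pr x y
  ∈prˡ = from pr-⇔ (inj₁ refl)

  ∈prʳ : ∀ {x y} → y ∈ pr x y
  ∈prʳ = from pr-⇔ (inj₂ refl)

  ≡pr⇒∈ˡ : ∀ {p x y} → p ≡ pr x y → x ∈ p
  ≡pr⇒∈ˡ refl = ∈prˡ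

  ≡pr⇒∈ʳ : ∀ {p x y} → p ≡ pr x y → y ∈ p
  ≡pr⇒∈ʳ refl = ∈prʳ

  ∈sg : ∀ {x z} → z ∈ pr x x → z ≡ x
  ∈sg = [ id , id ]′ ∘ to pr-⇔

  IsPair⇒≡ : ∀ {p x y} → IsPair p x y → p ≡ pr x y
  IsPair⇒≡ h = ⊆-antisym (λ z → from pr-⇔ ∘ to (h z)) (λ z → from (h z) ∘ to pr-⇔)

  pr-injʳ : ∀ {x y y′} → pr x y ≡ pr x y′ → y ≡ y′
  pr-injʳ {x} {y} {y′} e
    with to pr-⇔ (subst (y ∈_) e ∈prʳ) | to pr-⇔ (subst (y′ ∈_) (sym e) ∈prʳ)
  ... | inj₂ p | _      = p
  ... | inj₁ p | inj₂ q = sym q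
  ... | inj₁ p | inj₁ q = trans p (sym q)

  abstract
    ⟨_,_⟩ : S → S → S
    ⟨ x , y ⟩ = pr (pr x x) (pr x y)

    ⟨⟩-≡ : ∀ {x y} → ⟨ x , y ⟩ ≡ pr (pr x x) (pr x y)
    ⟨⟩-≡ = refl

    ⟨⟩-inj : ∀ {x y x′ y′} → ⟨ x , y ⟩ ≡ ⟨ x′ , y′ ⟩ → x ≡ x′ × y ≡ y′
    ⟨⟩-inj {x} {y} {x′} {y′} e = x≡x′ , y≡y′
      where
      x∈ : ∀ {s} → s ∈ ⟨ x′ , y′ ⟩ → x′ ∈ s
      x∈ h = [ (λ q → subst (x′ ∈_) (sym q) ∈prˡ) , (λ q → subst (x′ ∈_) (sym q) ∈prˡ) ]′ (to pr-⇔ h)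
      x≡x′ : x ≡ x′
      x≡x′ = sym (∈sg (x∈ (subst (pr x x ∈_) e ∈prˡ)))
      y≡y′ : y ≡ y′
      y≡y′ with refl ← x≡x′ = pr-injʳ (pr-injʳ e)

  IsOPair-⟨⟩ : ∀ {x y} → IsOPair ⟨ x , y ⟩ x y
  IsOPair-⟨⟩ {x} {y} = pr x x , pr x y , (λ _ → pr-⇔) , (λ _ → pr-⇔) ,
    subst (λ p → IsPair p (pr x x) (pr x y)) (sym ⟨⟩-≡) (λ _ → pr-⇔)

  IsOPair⇒≡ : ∀ {p x y} → IsOPair p x y → p ≡ ⟨ x , y ⟩
  IsOPair⇒≡ (_ , _ , a , b , c)
    with refl ← IsPair⇒≡ a | refl ← IsPair⇒≡ b = trans (IsPair⇒≡ c) (sym ⟨⟩-≡)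

  RelS-⇔ : ∀ {f x y} → RelS f x y ⇔ ⟨ x , y ⟩ ∈ f
  RelS-⇔ {f} = mk⇔ (λ (p , o , h) → subst (_∈ f) (IsOPair⇒≡ o) h) (λ h → _ , IsOPair-⟨⟩ , h)

  RelC-⇔ : ∀ {F x y} → RelC F x y ⇔ ⟨ x , y ⟩ ∈ᶜ F
  RelC-⇔ {F} = mk⇔ (λ (p , o , h) → subst (_∈ᶜ F) (IsOPair⇒≡ o) h) (λ h → _ , IsOPair-⟨⟩ , h)

  abstract
    ⋃ : S → S
    ⋃ x = proj₁ (union x)

    ⋃-⇔ : ∀ {x z} → z ∈ ⋃ x ⇔ (∃[ w ] (w ∈ x × z ∈ w))
    ⋃-⇔ {x} = proj₂ (union x) _

  abstract
    _∪_ : S → S → S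
    x ∪ y = ⋃ (pr x y)

    ∪-⇔ : ∀ {x y z} → z ∈ (x ∪ y) ⇔ (z ∈ x ⊎ z ∈ y)
    ∪-⇔ {x} {y} {z} = mk⇔ f g
      where
      f : z ∈ (x ∪ y) → z ∈ x ⊎ z ∈ y
      f h with to ⋃-⇔ h
      ... | w , hw , hz with to pr-⇔ hw
      ... | inj₁ refl = inj₁ hz
      ... | inj₂ refl = inj₂ hz
      g : z ∈ x ⊎ z ∈ y → z ∈ (x ∪ y)
      g (inj₁ h) = from ⋃-⇔ (x , ∈prˡ , h)
      g (inj₂ h) = from ⋃-⇔ (y , ∈prʳ , h)

  abstract
    𝒫 : S → S
    𝒫 x = proj₁ (powerset x)

    𝒫-⇔ : ∀ {x z} → z ∈ 𝒫 x ⇔ z ⊆ x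
    𝒫-⇔ {x} = proj₂ (powerset x) _

  abstract
    suc′ : S → S
    suc′ x = x ∪ pr x x

    suc′-⇔ : ∀ {x z} → z ∈ suc′ x ⇔ (z ∈ x ⊎ z ≡ x)
    suc′-⇔ = mk⇔ (λ h → [ inj₁ , inj₂ ∘ ∈sg ]′ (to ∪-⇔ h))
      [ from ∪-⇔ ∘ inj₁ , (λ { refl → from ∪-⇔ (inj₂ ∈prˡ) }) ]′

  IsSucc⇒≡ : ∀ {s x} → IsSucc s x → s ≡ suc′ x
  IsSucc⇒≡ h = ⊆-antisym (λ z → from suc′-⇔ ∘ to (h z)) (λ z → from (h z) ∘ to suc′-⇔)

  module _ {σ : ℕ → C} {Γ : Set} {e : Γ → ℕ → S} where

    abstract
      -- `IsPair` quantifies over all sets, whereas this formula bounds the quantifier by the pair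
      -- itself. Being Δ₀ is what later lets `j` commute with ordered pairs.
      prᵈ : ∀ i k l → Def Δ₀ σ e (λ γ → e γ i ≡ pr (e γ k) (e γ l))
      prᵈ i k l =
        conv (λ γ → mk⇔
               (λ (h , h′ , h″) → ⊆-antisym (λ z → from pr-⇔ ∘ h″ z)
                 (λ z → [ (λ { refl → h }) , (λ { refl → h′ }) ]′ ∘ to pr-⇔))
               (λ q → ≡pr⇒∈ˡ q , ≡pr⇒∈ʳ q ,
                      λ z → to pr-⇔ ∘ subst (z ∈_) q))
          (memᵈ k i ∧ᵈ memᵈ l i ∧ᵈ ∀∈ᵈ i (eqᵈ 0 (suc k) ∨ᵈ eqᵈ 0 (suc l)))

  module _ {σ : ℕ → C} {Γ : Set} {e : Γ → ℕ → S} where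

    abstract
      -- Both halves of a Kuratowski pair are elements of it, so the existential quantifiers over
      -- them can be bounded.
      opᵈ : ∀ i k l → Def Δ₀ σ e (λ γ → e γ i ≡ ⟨ e γ k , e γ l ⟩)
      opᵈ i k l =
        conv (λ γ → mk⇔ (λ { (s , _ , t , _ , refl , refl , q) → trans q (sym ⟨⟩-≡) })
                        (λ q → let q = trans q ⟨⟩-≡ in
                               _ , ≡pr⇒∈ˡ q , _ , ≡pr⇒∈ʳ q ,
                               refl , refl , q))
          (∃∈ᵈ i (∃∈ᵈ (suc i) (prᵈ 1 (2 + k) (2 + k) ∧ᵈ prᵈ 0 (2 + k) (2 + l) ∧ᵈ prᵈ (2 + i) 1 0)))

      sucᵈ : ∀ i k → Def Δ₀ σ e (λ γ → e γ i ≡ suc′ (e γ k))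
      sucᵈ i k =
        conv (λ γ → mk⇔
               (λ (h , h′ , h″) → ⊆-antisym (λ z → from suc′-⇔ ∘ h z)
                 (λ z → [ h′ z , (λ { refl → h″ }) ]′ ∘ to suc′-⇔))
               (λ q → (λ z → to suc′-⇔ ∘ subst (z ∈_) q) ,
                      (λ z → subst (z ∈_) (sym q) ∘ from suc′-⇔ ∘ inj₁) ,
                      subst (_ ∈_) (sym q) (from suc′-⇔ (inj₂ refl))))
          (∀∈ᵈ i (memᵈ 0 (suc k) ∨ᵈ eqᵈ 0 (suc k)) ∧ᵈ ∀∈ᵈ k (memᵈ 0 (suc i)) ∧ᵈ memᵈ k i)

      ⊆ᵈ : ∀ i k → Def Δ₀ σ e (λ γ → e γ i ⊆ e γ k)
      ⊆ᵈ i k = ∀∈ᵈ i (memᵈ 0 (suc k))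

      emptyᵈ : ∀ i → Def Δ₀ σ e (λ γ → IsEmpty (e γ i))
      emptyᵈ i = ∀∈ᵈ i ⊥ᵈ

      ∅ᵈ : ∀ i → Def Δ₀ σ e (λ γ → e γ i ≡ ∅)
      ∅ᵈ i = conv (λ γ → mk⇔ (λ h → ⊆-antisym (λ z → ⊥-elim ∘ h z) (λ z → ⊥-elim ∘ ∅-empty z))
                               (λ q z → ∅-empty z ∘ subst (z ∈_) q)) (emptyᵈ i)

  module _ {σ : ℕ → C} {Γ : Set} {e : Γ → ℕ → S} where

    abstract
      appᵈ : ∀ f i k → Def Δ₀ σ e (λ γ → ⟨ e γ i , e γ k ⟩ ∈ e γ f)
      appᵈ f i k = conv (λ γ → mk⇔ (λ { (_ , h , refl) → h }) (λ h → _ , h , refl))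
        (∃∈ᵈ f (opᵈ 0 (suc i) (suc k)))

      appᶜ : ∀ X i k → Def Predicative σ e (λ γ → ⟨ e γ i , e γ k ⟩ ∈ᶜ σ X)
      appᶜ X i k = conv (λ γ → mk⇔ (λ { (_ , refl , h) → h }) (λ h → _ , refl , h))
        (∃ᵖ (⌜ opᵈ 0 (suc i) (suc k) ⌝ ∧ᵖ memᶜᵖ 0 X))

  Class : (σ : ℕ → C) → List S → (S → Set) → Set
  Class σ l = Def Predicative σ (λ z → ext z (env l))

  -- Variable 0 is the second component, 1 the first, 2 the pair; the
  -- parameters start at 3.
  Class₂ : (σ : ℕ → C) → List S → (S → S → Set) → Set
  Class₂ σ l R = Def Predicative σ (((λ z → ext z (env l)) ▸) ▸)
                   (λ p → R (proj₂ (proj₁ p)) (proj₂ p))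

  module _ {σ : ℕ → C} where

    abstract
      class : ∀ l {P} → Class σ l P → ∃[ X ] (∀ z → z ∈ᶜ X ⇔ P z)
      class l (def φ k s) with comprehension φ k (env l) σ
      ... | X , h = X , λ z → s z ⇔-∘ h z

      class₂ : ∀ l {R} → Class₂ σ l R → ∃[ X ] (∀ x y → ⟨ x , y ⟩ ∈ᶜ X ⇔ R x y)
      class₂ l d
        with class l (∃ᵖ (∃ᵖ (⌜ opᵈ 2 1 0 ⌝ ∧ᵖ d)))
      ... | X , h = X , λ x y →
        mk⇔ (λ { (x′ , y′ , q , r) → case ⟨⟩-inj q of λ { (refl , refl) → r } })
            (λ r → _ , _ , refl , r) ⇔-∘ h ⟨ x , y ⟩

      separate : ∀ a l {P} → Class σ l P → ∃[ b ] (∀ z → z ∈ b ⇔ (z ∈ a × P z))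
      separate a l d with class l d
      ... | X , h with separation X a
      ... | b , k = b , λ z → mk⇔ (λ (p , q) → p , to (h z) q) (λ (p , q) → p , from (h z) q)
                              ⇔-∘ k z

  module _ (a b : S) where

    private
      product : ∃[ r ] (∀ p → p ∈ r ⇔ (p ∈ 𝒫 (𝒫 (a ∪ b)) ×
                                          ∃[ x ] ∃[ y ] (p ≡ ⟨ x , y ⟩ × x ∈ a × y ∈ b)))
      -- A formula is interpreted in an environment of classes even when it mentions none. The class
      -- given by global choice fills it, since `comprehension` already presupposes such an
      -- environment.
      product = separate {σ = λ _ → proj₁ global-choice} (𝒫 (𝒫 (a ∪ b))) (a ∷ b ∷ [])
        (∃ᵖ (∃ᵖ (⌜ opᵈ 2 1 0 ⌝ ∧ᵖ ⌜ memᵈ 1 3 ⌝ ∧ᵖ ⌜ memᵈ 0 4 ⌝)))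

    infixr 8 _×ˢ_
    abstract
      _×ˢ_ : S
      _×ˢ_ = proj₁ product

      ×ˢ⇒ : ∀ {p} → p ∈ _×ˢ_ → ∃[ x ] ∃[ y ] (p ≡ ⟨ x , y ⟩ × x ∈ a × y ∈ b)
      ×ˢ⇒ = proj₂ ∘ to (proj₂ product _)

      ⟨⟩∈×ˢ : ∀ {x y} → x ∈ a → y ∈ b → ⟨ x , y ⟩ ∈ _×ˢ_
      ⟨⟩∈×ˢ {x} {y} hx hy = from (proj₂ product _) (from 𝒫-⇔ bound , x , y , refl , hx , hy)
        where
        x∈ : x ∈ (a ∪ b)
        x∈ = from ∪-⇔ (inj₁ hx)
        y∈ : y ∈ (a ∪ b)
        y∈ = from ∪-⇔ (inj₂ hy)
        bound : ⟨ x , y ⟩ ⊆ 𝒫 (a ∪ b)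
        bound z h with to pr-⇔ (subst (z ∈_) ⟨⟩-≡ h)
        ... | inj₁ refl = from 𝒫-⇔ λ u k → subst (_∈ (a ∪ b)) (sym (∈sg k)) x∈
        ... | inj₂ refl = from 𝒫-⇔ λ u k →
                [ (λ { refl → x∈ }) , (λ { refl → y∈ }) ]′ (to pr-⇔ k)

  _⊆_⊗_ : S → S → S → Set
  r ⊆ a ⊗ b = ∀ p → p ∈ r → ∃[ x ] (x ∈ a × ∃[ y ] (y ∈ b × p ≡ ⟨ x , y ⟩))

  module _ {σ : ℕ → C} (a b : S) (l : List S) {R : S → S → Set} (d : Class₂ σ l R) where

    private
      cut : ∃[ r ] (∀ p → p ∈ r ⇔ (p ∈ (a ×ˢ b) × ∃[ x ] ∃[ y ] (p ≡ ⟨ x , y ⟩ × R x y)))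
      cut = separate (a ×ˢ b) l (∃ᵖ (∃ᵖ (⌜ opᵈ 2 1 0 ⌝ ∧ᵖ d)))

    relation : S
    relation = proj₁ cut

    relation⊆ : relation ⊆ a ⊗ b
    relation⊆ p hp with ×ˢ⇒ a b (proj₁ (to (proj₂ cut p) hp))
    ... | x , y , q , hx , hy = x , hx , y , hy , q

    relation-⇔ : ∀ x y → ⟨ x , y ⟩ ∈ relation ⇔ (x ∈ a × y ∈ b × R x y)
    relation-⇔ x y = mk⇔ f λ (hx , hy , k) →
      from (proj₂ cut _) (⟨⟩∈×ˢ a b hx hy , x , y , refl , k)
      where
      f : ⟨ x , y ⟩ ∈ relation → x ∈ a × y ∈ b × R x y
      f hp with to (proj₂ cut _) hp
      ... | k , x′ , y′ , q , hr with ⟨⟩-inj q | ×ˢ⇒ a b k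
      ... | refl , refl | x″ , y″ , q′ , hx , hy with refl , refl ← ⟨⟩-inj q′ = hx , hy , hr

-- The natural numbers without foundation.

module NaturalNumbers (em : ExcludedMiddle 0ℓ) (M : Structure) (gbc : GBC⁻ᶠ M) where
  open SetTheory em M gbc

  Inductive : S → Set
  Inductive w = ∅ ∈ w × (∀ x → x ∈ w → suc′ x ∈ w)

  abstract
    inductiveᵈ : ∀ {σ} {Γ : Set} {e : Γ → ℕ → S} i → Def Δ₀ σ e (λ γ → Inductive (e γ i))
    inductiveᵈ i =
      conv (λ γ → mk⇔ (λ { ((_ , h , refl) , k) → h , λ x hx → case k x hx of λ { (_ , q , refl) → q } })
                      (λ (h , k) → (_ , h , refl) , λ x hx → _ , k x hx , refl))
        (∃∈ᵈ i (∅ᵈ 0) ∧ᵈ ∀∈ᵈ i (∃∈ᵈ (suc i) (sucᵈ 0 1)))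

  σ₀ : ℕ → C
  σ₀ _ = proj₁ global-choice

  private
    I : S
    I = proj₁ infinity

    I-inductive : Inductive I
    I-inductive with infinity
    ... | I , (e , e-empty , e∈I) , h =
      subst (_∈ I) (⊆-antisym (λ z → ⊥-elim ∘ e-empty z) (λ z → ⊥-elim ∘ ∅-empty z)) e∈I ,
      λ x hx → case h x hx of λ (s , hs , s∈) → subst (_∈ I) (IsSucc⇒≡ hs) s∈

    ω-exists : ∃[ w ] (∀ z → z ∈ w ⇔ (z ∈ I × (∀ v → Inductive v → z ∈ v)))
    ω-exists = separate {σ = σ₀} I [] (∀ᵖ (⌜ inductiveᵈ 0 ⌝ ⇒ᵖ ⌜ memᵈ 1 0 ⌝))

  abstract
    -- The intersection of all inductive sets, not the set of finite ordinals: induction is then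
    -- immediate, and the facts usually read off from foundation are derived by it.
    ω : S
    ω = proj₁ ω-exists

    ω-least : ∀ v → Inductive v → ω ⊆ v
    ω-least v h z hz = proj₂ (to (proj₂ ω-exists z) hz) v h

    ω-inductive : Inductive ω
    ω-inductive =
      from (proj₂ ω-exists _) (proj₁ I-inductive , λ v h → proj₁ h) ,
      λ x hx → from (proj₂ ω-exists _)
        (proj₂ I-inductive x (proj₁ (to (proj₂ ω-exists x) hx)) ,
         λ v h → proj₂ h x (ω-least v h x hx))

  ∅∈ω : ∅ ∈ ω
  ∅∈ω = proj₁ ω-inductive

  suc′∈ω : ∀ {n} → n ∈ ω → suc′ n ∈ ω
  suc′∈ω = proj₂ ω-inductive _

  abstract
    ω-induction : ∀ {σ} l {P} → Class σ l P → P ∅ → (∀ n → n ∈ ω → P n → P (suc′ n))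
                → ∀ n → n ∈ ω → P n
    ω-induction l {P} d P∅ Psuc n hn with separate ω l d
    ... | b , h = proj₂ (to (h n) (ω-least b
          (from (h ∅) (∅∈ω , P∅) ,
           λ x hx → let (x∈ω , Px) = to (h x) hx in from (h _) (suc′∈ω x∈ω , Psuc x x∈ω Px)) n hn))

  ∈-suc′ : ∀ {x} → x ∈ suc′ x
  ∈-suc′ = from suc′-⇔ (inj₂ refl)

  ∈⇒∈-suc′ : ∀ {x y} → x ∈ y → x ∈ suc′ y
  ∈⇒∈-suc′ = from suc′-⇔ ∘ inj₁

  ∅≢suc′ : ∀ {x} → ¬ ∅ ≡ suc′ x
  ∅≢suc′ q = ∅-empty _ (subst (_ ∈_) (sym q) ∈-suc′)

  ω-transitive : ∀ n → n ∈ ω → Transitive n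
  ω-transitive = ω-induction {σ = σ₀} []
    (∀ᵖ (∀ᵖ (⌜ memᵈ 0 2 ⌝ ⇒ᵖ (⌜ memᵈ 1 0 ⌝ ⇒ᵖ ⌜ memᵈ 1 2 ⌝))))
    (λ z w hw → ⊥-elim (∅-empty w hw))
    (λ n _ ih z w hw hz → ∈⇒∈-suc′
      ([ (λ h → ih z w h hz) , (λ { refl → hz }) ]′ (to suc′-⇔ hw)))

  -- If `suc′ n ∈ suc′ n`, then `suc′ n` is an element of `n` or equal to it. Both give `n ∈ n`, the
  -- first by transitivity of `n`.
  ω-irreflexive : ∀ n → n ∈ ω → ¬ n ∈ n
  ω-irreflexive = ω-induction {σ = σ₀} [] (¬ᵖ ⌜ memᵈ 0 0 ⌝) (∅-empty ∅)
    (λ n hn ih h → [ (λ k → ih (ω-transitive n hn n (suc′ n) k ∈-suc′)) ,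
                     (λ q → ih (subst (n ∈_) q ∈-suc′)) ]′ (to suc′-⇔ h))

  -- Otherwise `m ∈ n` and `n ∈ m`, and transitivity of `m` gives `m ∈ m`.
  suc′-injective : ∀ {m n} → m ∈ ω → suc′ m ≡ suc′ n → m ≡ n
  suc′-injective {m} {n} hm q
    with to suc′-⇔ (subst (m ∈_) q ∈-suc′) | to suc′-⇔ (subst (n ∈_) (sym q) ∈-suc′)
  ... | inj₂ r | _      = r
  ... | inj₁ _ | inj₂ r = sym r
  ... | inj₁ r | inj₁ s = ⊥-elim (ω-irreflexive m hm (ω-transitive m hm m n s r))

  ∅≤ : ∀ n → n ∈ ω → ∅ ≡ n ⊎ ∅ ∈ n
  ∅≤ = ω-induction {σ = σ₀} (∅ ∷ []) (⌜ eqᵈ 1 0 ⌝ ∨ᵖ ⌜ memᵈ 1 0 ⌝) (inj₁ refl)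
    λ n _ → [ (λ { refl → inj₂ ∈-suc′ }) , inj₂ ∘ ∈⇒∈-suc′ ]′

  suc′-mono : ∀ m n → n ∈ ω → m ∈ n → suc′ m ∈ suc′ n
  suc′-mono m = ω-induction {σ = σ₀} (m ∷ [])
    -- The language has no successor term, so the formula introduces both successors by existential
    -- quantifiers.
    (conv (λ _ → mk⇔ (λ { h p → case h p of λ { (_ , refl , _ , refl , r) → r } })
                     (λ h p → _ , refl , _ , refl , h p))
      (⌜ memᵈ 1 0 ⌝ ⇒ᵖ ∃ᵖ (⌜ sucᵈ 0 2 ⌝ ∧ᵖ ∃ᵖ (⌜ sucᵈ 0 2 ⌝ ∧ᵖ ⌜ memᵈ 1 0 ⌝))))
    (λ h → ⊥-elim (∅-empty m h))
    (λ n _ ih h → [ ∈⇒∈-suc′ ∘ ih , (λ { refl → ∈-suc′ }) ]′ (to suc′-⇔ h))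

  trichotomy : ∀ m → m ∈ ω → ∀ n → n ∈ ω → m ∈ n ⊎ m ≡ n ⊎ n ∈ m
  trichotomy m hm = ω-induction {σ = σ₀} (m ∷ [])
    (⌜ memᵈ 1 0 ⌝ ∨ᵖ ⌜ eqᵈ 1 0 ⌝ ∨ᵖ ⌜ memᵈ 0 1 ⌝)
    (inj₂ ([ inj₁ ∘ sym , inj₂ ]′ (∅≤ m hm)))
    λ n hn → [ inj₁ ∘ ∈⇒∈-suc′ , [ (λ { refl → inj₁ ∈-suc′ }) ,
      (λ h → [ inj₂ ∘ inj₂ , inj₂ ∘ inj₁ ∘ sym ]′ (to suc′-⇔ (suc′-mono n m hm h))) ]′ ]′

  -- Recursion along `ω`.

  record Sequence (step : S → S) (a : S) : Set where
    field
      seq values  : S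
      seq⊆        : seq ⊆ ω ⊗ values
      functional  : ∀ n y y′ → ⟨ n , y ⟩ ∈ seq → ⟨ n , y′ ⟩ ∈ seq → y ≡ y′
      total       : ∀ n → n ∈ ω → ∃[ y ] ⟨ n , y ⟩ ∈ seq
      start       : ⟨ ∅ , a ⟩ ∈ seq
      next        : ∀ n y → n ∈ ω → ⟨ n , y ⟩ ∈ seq → ⟨ suc′ n , step y ⟩ ∈ seq
      surjective  : ∀ y → y ∈ values → ∃[ n ] (n ∈ ω × ⟨ n , y ⟩ ∈ seq)

  module Recursion (step : S → S) (X : C) (X-⇔ : ∀ x y → ⟨ x , y ⟩ ∈ᶜ X ⇔ step x ≡ y)
                   (a : S) where

    -- Neither functionality nor a domain is demanded, so an attempt survives the addition of a
    -- justified pair (`good-next`); uniqueness of values comes afterwards by induction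
    -- (`good-unique`). The class `X` stands in for `step`, which no formula can mention.
    Attempt : S → Set
    Attempt p = ∀ q → q ∈ p → q ≡ ⟨ ∅ , a ⟩ ⊎
      (∃[ m ] ∃[ w ] ∃[ m′ ] ∃[ w′ ]
        (m ∈ ω × ⟨ m , w ⟩ ∈ p × m′ ≡ suc′ m × ⟨ w , w′ ⟩ ∈ᶜ X × q ≡ ⟨ m′ , w′ ⟩))

    Good : S → S → Set
    Good n y = ∃[ p ] (Attempt p × ⟨ n , y ⟩ ∈ p)

    abstract
      good : ∃[ G ] (∀ n y → ⟨ n , y ⟩ ∈ᶜ G ⇔ Good n y)
      good = class₂ {σ = λ _ → X} (∅ ∷ a ∷ ω ∷ [])
        (∃ᵖ (∀ᵖ (⌜ memᵈ 0 1 ⌝ ⇒ᵖ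
                  (⌜ opᵈ 0 5 6 ⌝ ∨ᵖ
                   ∃ᵖ (∃ᵖ (∃ᵖ (∃ᵖ
                     (⌜ memᵈ 3 11 ⌝ ∧ᵖ ⌜ appᵈ 5 3 2 ⌝ ∧ᵖ ⌜ sucᵈ 1 3 ⌝ ∧ᵖ appᶜ 0 2 0 ∧ᵖ ⌜ opᵈ 4 1 0 ⌝))))))
             ∧ᵖ ⌜ appᵈ 0 2 1 ⌝))

      goodᵖ : ∀ {Γ : Set} {e : Γ → ℕ → S} i k →
              Def Predicative (λ _ → proj₁ good) e (λ γ → Good (e γ i) (e γ k))
      goodᵖ i k = conv (λ _ → proj₂ good _ _) (appᶜ 0 i k)

    start-unique : ∀ {y} → Good ∅ y → y ≡ a
    start-unique (p , att , h) with att _ h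
    ... | inj₁ q = proj₂ (⟨⟩-inj q)
    ... | inj₂ (_ , _ , _ , _ , _ , _ , refl , _ , q) = ⊥-elim (∅≢suc′ (proj₁ (⟨⟩-inj q)))

    next-unique : ∀ {n y} → n ∈ ω → Good (suc′ n) y → ∃[ w ] (Good n w × y ≡ step w)
    next-unique hn (p , att , h) with att _ h
    ... | inj₁ q = ⊥-elim (∅≢suc′ (sym (proj₁ (⟨⟩-inj q))))
    ... | inj₂ (m , w , _ , w′ , hm , hp , refl , hX , q) with ⟨⟩-inj q
    ... | r , refl with refl ← suc′-injective hn r = w , (p , att , hp) , sym (to (X-⇔ w w′) hX)

    good-start : Good ∅ a
    good-start = pr ⟨ ∅ , a ⟩ ⟨ ∅ , a ⟩ , (λ q h → inj₁ (∈sg h)) , ∈prˡ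

    good-next : ∀ {n y} → n ∈ ω → Good n y → Good (suc′ n) (step y)
    good-next {n} {y} hn (p , att , h) = p ∪ pr z z , att′ , from ∪-⇔ (inj₂ ∈prˡ)
      where
      z = ⟨ suc′ n , step y ⟩
      att′ : Attempt (p ∪ pr z z)
      att′ q k with to ∪-⇔ k
      ... | inj₂ k with refl ← ∈sg k =
        inj₂ (n , y , _ , _ , hn , from ∪-⇔ (inj₁ h) , refl , from (X-⇔ _ _) refl , refl)
      ... | inj₁ k with att q k
      ... | inj₁ r = inj₁ r
      ... | inj₂ (m , w , m′ , w′ , hm , hp , r) =
        inj₂ (m , w , m′ , w′ , hm , from ∪-⇔ (inj₁ hp) , r)

    good-unique : ∀ n → n ∈ ω → ∃[ y ] (Good n y × (∀ y′ → Good n y′ → y′ ≡ y))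
    good-unique = ω-induction {σ = λ _ → proj₁ good} []
      (∃ᵖ (goodᵖ 1 0 ∧ᵖ ∀ᵖ (goodᵖ 2 0 ⇒ᵖ ⌜ eqᵈ 0 1 ⌝)))
      (a , good-start , λ y′ → start-unique)
      (λ n hn (y , h , u) → step y , good-next hn h , λ y′ h′ →
        case next-unique hn h′ of λ { (w , hw , refl) → cong step (u w hw) })

    private
      range : ∃[ R ] (∀ y → y ∈ R ⇔ (∃[ n ] (n ∈ ω × RelC (proj₁ good) n y)))
      -- No set containing all values is known in advance, so replacement has to supply one before
      -- `relation` can cut out the sequence.
      range = replacement (proj₁ good) ω functional
        where
        functional : ∀ n → n ∈ ω →
          ∃[ y ] (RelC (proj₁ good) n y × (∀ y′ → RelC (proj₁ good) n y′ → y′ ≡ y))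
        functional n hn with good-unique n hn
        ... | y , h , u = y , from RelC-⇔ (from (proj₂ good n y) h) ,
                          λ y′ r → u y′ (to (proj₂ good n y′) (to RelC-⇔ r))

      f : S
      f = relation ω (proj₁ range) [] {R = Good} (goodᵖ 1 0)

      hf : ∀ x y → ⟨ x , y ⟩ ∈ f ⇔ (x ∈ ω × y ∈ proj₁ range × Good x y)
      hf = relation-⇔ ω (proj₁ range) [] {R = Good} (goodᵖ 1 0)

      app⇒good : ∀ {n y} → ⟨ n , y ⟩ ∈ f → Good n y
      app⇒good h = proj₂ (proj₂ (to (hf _ _) h))

      good⇒app : ∀ {n y} → n ∈ ω → Good n y → ⟨ n , y ⟩ ∈ f
      good⇒app hn h = from (hf _ _)
        (hn , from (proj₂ range _) (_ , hn , from RelC-⇔ (from (proj₂ good _ _) h)) , h)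

    abstract
      sequence : Sequence step a
      sequence = record
        { seq        = f
        ; values     = proj₁ range
        ; seq⊆       = relation⊆ ω (proj₁ range) [] {R = Good} (goodᵖ 1 0)
        ; functional = λ n y y′ h h′ → case good-unique n (proj₁ (to (hf n y) h)) of λ (_ , _ , u) →
            trans (u y (app⇒good h)) (sym (u y′ (app⇒good h′)))
        ; total      = λ n hn → case good-unique n hn of λ (y , h , _) → y , good⇒app hn h
        ; start      = good⇒app ∅∈ω good-start
        ; next       = λ n y hn h → good⇒app (suc′∈ω hn) (good-next hn (app⇒good h))
        ; surjective = λ y hy → case to (proj₂ range y) hy of λ (n , hn , r) →
            n , hn , good⇒app hn (to (proj₂ good n y) (to RelC-⇔ r))
        }

-- Definable selection by global choice.

module Choice (em : ExcludedMiddle 0ℓ) (M : Structure) (gbc : GBC⁻ᶠ M) where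
  open SetTheory em M gbc

  module Selector {σ : ℕ → C} (E : S) (l : List S) {R : S → S → Set} (d : Class₂ σ l R) where

    private
      G X : C
      G = proj₁ global-choice
      X = proj₁ (class₂ l {R = R} d)

      X-⇔ : ∀ x y → ⟨ x , y ⟩ ∈ᶜ X ⇔ R x y
      X-⇔ = proj₂ (class₂ l {R = R} d)

      fibre-exists : ∀ x → ∃[ c ] (∀ z → z ∈ c ⇔ (z ∈ E × ⟨ x , z ⟩ ∈ᶜ X))
      fibre-exists x = separate {σ = λ _ → X} E (x ∷ []) (appᶜ 0 1 0)

    abstract
      fibre : S → S
      fibre x = proj₁ (fibre-exists x)

      fibre-⇔ : ∀ {x z} → z ∈ fibre x ⇔ (z ∈ E × ⟨ x , z ⟩ ∈ᶜ X)
      fibre-⇔ {x} = proj₂ (fibre-exists x) _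

      -- `G` is applied to the fibre and not to `x`, so equal nonempty fibres yield equal choices.
      -- On an empty fibre the default is `x`, which keeps the graph total and definable.
      select : S → S
      select x with em {∃[ z ] (z ∈ fibre x)}
      ... | yes h = proj₁ (proj₂ global-choice (fibre x) h)
      ... | no _  = x

    Selects : S → S → S → Set
    Selects x c y = (y ∈ c × ⟨ c , y ⟩ ∈ᶜ G) ⊎ (IsEmpty c × x ≡ y)

    abstract
      selects-⇔ : ∀ x y → Selects x (fibre x) y ⇔ select x ≡ y
      selects-⇔ x y with em {∃[ z ] (z ∈ fibre x)}
      ... | no ¬h = mk⇔ (λ { (inj₁ (h , _)) → ⊥-elim (¬h (y , h)) ; (inj₂ (_ , q)) → q })
                        (λ q → inj₂ ((λ z h → ¬h (z , h)) , q))
      ... | yes h with proj₂ global-choice (fibre x) h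
      ... | y₀ , y₀∈ , hG , unique =
        mk⇔ (λ { (inj₁ (_ , k)) → sym (unique y (from RelC-⇔ k))
               ; (inj₂ (e , _)) → ⊥-elim (e _ y₀∈) })
            (λ { refl → inj₁ (y₀∈ , to RelC-⇔ hG) })

    abstract
      -- The formula cannot name `fibre x`. It introduces a set `c` with the same elements, which
      -- extensionality then identifies with the fibre.
      graph : ∃[ Y ] (∀ x y → ⟨ x , y ⟩ ∈ᶜ Y ⇔
        (∃[ c ] ((∀ z → (z ∈ c → z ∈ E × ⟨ x , z ⟩ ∈ᶜ X) × (z ∈ E × ⟨ x , z ⟩ ∈ᶜ X → z ∈ c))
                × Selects x c y)))
      graph = class₂ {σ = ext X (λ _ → G)} (E ∷ [])
        (∃ᵖ (∀ᵖ ((⌜ memᵈ 0 1 ⌝ ⇒ᵖ (⌜ memᵈ 0 5 ⌝ ∧ᵖ appᶜ 0 3 0)) ∧ᵖ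
                 ((⌜ memᵈ 0 5 ⌝ ∧ᵖ appᶜ 0 3 0) ⇒ᵖ ⌜ memᵈ 0 1 ⌝))
             ∧ᵖ ((⌜ memᵈ 1 0 ⌝ ∧ᵖ appᶜ 1 0 1) ∨ᵖ (⌜ emptyᵈ 0 ⌝ ∧ᵖ ⌜ eqᵈ 2 1 ⌝))))

    abstract
      selector : C
      selector = proj₁ graph

      selector-⇔ : ∀ x y → ⟨ x , y ⟩ ∈ᶜ selector ⇔ select x ≡ y
      selector-⇔ x y = mk⇔
        (λ h → case to (proj₂ graph x y) h of λ (c , hc , k) →
          to (selects-⇔ x y) (subst (λ c → Selects x c y)
            (⊆-antisym (λ z → from fibre-⇔ ∘ proj₁ (hc z)) (λ z → proj₂ (hc z) ∘ to fibre-⇔)) k))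
        (λ q → from (proj₂ graph x y)
          (fibre x , (λ z → to fibre-⇔ , from fibre-⇔) , from (selects-⇔ x y) q))

      select-spec : ∀ {x y} → y ∈ E → R x y → select x ∈ E × R x (select x)
      select-spec {x} {y} hy r with from (selects-⇔ x (select x)) refl
      ... | inj₁ (h , _) = let (p , q) = to fibre-⇔ h in p , to (X-⇔ _ _) q
      ... | inj₂ (e , _) = ⊥-elim (e y (from fibre-⇔ (hy , from (X-⇔ _ _) r)))

      -- Equal fibres are one and the same argument of `G`; this is how representatives of
      -- equivalence classes get chosen. The witness `y` rules out the default value, which depends
      -- on `x`.
      select-cong : ∀ {x x′ y} → y ∈ E → R x y → (∀ z → z ∈ E → R x z ⇔ R x′ z)
                  → select x ≡ select x′
      select-cong {x} {x′} {y} hy r h with from (selects-⇔ x (select x)) refl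
      ... | inj₂ (e , _) = ⊥-elim (e y (from fibre-⇔ (hy , from (X-⇔ _ _) r)))
      ... | inj₁ k = sym (to (selects-⇔ x′ _) (subst (λ c → Selects x′ c (select x)) fibre≡ (inj₁ k)))
        where
        fibre≡ : fibre x ≡ fibre x′
        fibre≡ = ⊆-antisym
          (λ z k → let (p , q) = to fibre-⇔ k in
                   from fibre-⇔ (p , from (X-⇔ _ _) (to (h z p) (to (X-⇔ _ _) q))))
          (λ z k → let (p , q) = to fibre-⇔ k in
                   from fibre-⇔ (p , from (X-⇔ _ _) (from (h z p) (to (X-⇔ _ _) q))))

-- Functions, injections and the Jónsson property.

module Functions (em : ExcludedMiddle 0ℓ) (M : Structure) (gbc : GBC⁻ᶠ M) where
  open SetTheory em M gbc

  Total : S → S → S → Set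
  Total f a b = ∀ x → x ∈ a → ∃[ y ] (y ∈ b × ⟨ x , y ⟩ ∈ f)

  -- All quantifiers are bounded by `a` and `b`, so that the notion is Δ₀ and `j` transfers it in
  -- both directions.
  SingleValued : S → S → S → Set
  SingleValued f a b = ∀ x → x ∈ a → ∀ y → y ∈ b → ∀ y′ → y′ ∈ b →
                       ⟨ x , y ⟩ ∈ f → ⟨ x , y′ ⟩ ∈ f → y ≡ y′

  Function : S → S → S → Set
  Function f a b = f ⊆ a ⊗ b × Total f a b × SingleValued f a b

  -- Several values are allowed, as long as distinct points share none.
  Injection : S → S → S → Set
  Injection f a b = Total f a b × (∀ x → x ∈ a → ∀ x′ → x′ ∈ a → ∀ y → y ∈ b →
                                   ⟨ x , y ⟩ ∈ f → ⟨ x′ , y ⟩ ∈ f → x ≡ x′)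

  -- F maps W, the sequences indexed by ω, to W.
  Hits : (ω W F B a : S) → Set
  Hits ω W F B a = ∃[ s ] (s ∈ W × ∃[ y ] (y ∈ W × ⟨ s , y ⟩ ∈ F
                     × (∃[ n ] (n ∈ ω × ⟨ n , a ⟩ ∈ y)) × Total s ω B))

  -- The property of `A` that `j` has to carry over. Size is expressed by the injection `g`, and the
  -- only unbounded quantifiers, over `B` and `g`, are universal and in front, which makes it Π₁.
  Jónsson : (ω W F Z A : S) → Set
  Jónsson ω W F Z A = ∀ B g → Injection g Z B → B ⊆ A → ∀ a → a ∈ A → Hits ω W F B a

  module _ {σ : ℕ → C} {Γ : Set} {e : Γ → ℕ → S} where

    abstract
      ⊗ᵈ : ∀ f a b → Def Δ₀ σ e (λ γ → e γ f ⊆ e γ a ⊗ e γ b)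
      ⊗ᵈ f a b = ∀∈ᵈ f (∃∈ᵈ (1 + a) (∃∈ᵈ (2 + b) (opᵈ 2 1 0)))

      totalᵈ : ∀ f a b → Def Δ₀ σ e (λ γ → Total (e γ f) (e γ a) (e γ b))
      totalᵈ f a b = ∀∈ᵈ a (∃∈ᵈ (1 + b) (appᵈ (2 + f) 1 0))

      singleValuedᵈ : ∀ f a b → Def Δ₀ σ e (λ γ → SingleValued (e γ f) (e γ a) (e γ b))
      singleValuedᵈ f a b = ∀∈ᵈ a (∀∈ᵈ (1 + b) (∀∈ᵈ (2 + b)
        (appᵈ (3 + f) 2 1 ⇒ᵈ appᵈ (3 + f) 2 0 ⇒ᵈ eqᵈ 1 0)))

      injectionᵈ : ∀ f a b → Def Δ₀ σ e (λ γ → Injection (e γ f) (e γ a) (e γ b))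
      injectionᵈ f a b = ∀∈ᵈ a (∃∈ᵈ (1 + b) (appᵈ (2 + f) 1 0)) ∧ᵈ
        ∀∈ᵈ a (∀∈ᵈ (1 + a) (∀∈ᵈ (2 + b)
          (appᵈ (3 + f) 2 0 ⇒ᵈ appᵈ (3 + f) 1 0 ⇒ᵈ eqᵈ 2 1)))

  module _ {σ : ℕ → C} {Γ : Set} {e : Γ → ℕ → S} where

    abstract
      functionᵈ : ∀ f a b → Def Δ₀ σ e (λ γ → Function (e γ f) (e γ a) (e γ b))
      functionᵈ f a b = ⊗ᵈ f a b ∧ᵈ totalᵈ f a b ∧ᵈ singleValuedᵈ f a b

      hitsᵈ : ∀ w W F B a →
              Def Δ₀ σ e (λ γ → Hits (e γ w) (e γ W) (e γ F) (e γ B) (e γ a))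
      hitsᵈ w W F B a = ∃∈ᵈ W (∃∈ᵈ (1 + W)
        (appᵈ (2 + F) 1 0 ∧ᵈ ∃∈ᵈ (2 + w) (appᵈ 1 0 (3 + a)) ∧ᵈ totalᵈ 1 (2 + w) (2 + B)))

-- The Galvin-Prikry argument.

module JónssonFunction (em : ExcludedMiddle 0ℓ) (M : Structure) (gbc : GBC⁻ᶠ M)
                       (Z : Structure.S M) where
  open SetTheory em M gbc
  open NaturalNumbers em M gbc
  open Choice em M gbc
  open Functions em M gbc

  private
    sequences : ∃[ W ] (∀ s → s ∈ W ⇔ (s ∈ 𝒫 (ω ×ˢ Z) × Function s ω Z))
    sequences = separate {σ = σ₀} (𝒫 (ω ×ˢ Z)) (ω ∷ Z ∷ []) ⌜ functionᵈ 0 1 2 ⌝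

  abstract
    W : S
    W = proj₁ sequences

    W-⇔ : ∀ {s} → s ∈ W ⇔ Function s ω Z
    W-⇔ = mk⇔ (proj₂ ∘ to (proj₂ sequences _)) λ h → from (proj₂ sequences _)
      (from 𝒫-⇔ (λ p hp → case proj₁ h p hp of λ { (n , hn , v , hv , refl) → ⟨⟩∈×ˢ ω Z hn hv }) , h)

  SameAt : S → S → S → Set
  SameAt s t n = ∀ v → (⟨ n , v ⟩ ∈ s → ⟨ n , v ⟩ ∈ t) × (⟨ n , v ⟩ ∈ t → ⟨ n , v ⟩ ∈ s)

  SameAfter : S → S → S → Set
  SameAfter s t m = ∀ n → n ∈ ω → m ∈ n → SameAt s t n

  _~_ : S → S → Set
  s ~ t = ∃[ m ] (m ∈ ω × SameAfter s t m)

  abstract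
    ~-def : Class₂ σ₀ (ω ∷ []) _~_
    ~-def = ∃ᵖ (⌜ memᵈ 0 4 ⌝ ∧ᵖ ∀ᵖ (⌜ memᵈ 0 5 ⌝ ⇒ᵖ ⌜ memᵈ 1 0 ⌝ ⇒ᵖ
      ∀ᵖ ((⌜ appᵈ 4 1 0 ⌝ ⇒ᵖ ⌜ appᵈ 3 1 0 ⌝) ∧ᵖ (⌜ appᵈ 3 1 0 ⌝ ⇒ᵖ ⌜ appᵈ 4 1 0 ⌝))))

  ~-refl : ∀ {s} → s ~ s
  ~-refl = ∅ , ∅∈ω , λ _ _ _ _ → id , id

  ~-sym : ∀ {s t} → s ~ t → t ~ s
  ~-sym (m , hm , h) = m , hm , λ n hn k v → proj₂ (h n hn k v) , proj₁ (h n hn k v)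

  ~-trans : ∀ {s t u} → s ~ t → t ~ u → s ~ u
  ~-trans {s} {t} {u} (m , hm , h) (m′ , hm′ , h′) with trichotomy m hm m′ hm′
  ... | inj₁ m∈m′ = m′ , hm′ , λ n hn k v →
          let (f , g) = h n hn (ω-transitive n hn m m′ k m∈m′) v ; (f′ , g′) = h′ n hn k v
          in f′ ∘ f , g ∘ g′
  ... | inj₂ (inj₁ refl) = m , hm , λ n hn k v →
          let (f , g) = h n hn k v ; (f′ , g′) = h′ n hn k v in f′ ∘ f , g ∘ g′
  ... | inj₂ (inj₂ m′∈m) = m , hm , λ n hn k v →
          let (f , g) = h n hn k v ; (f′ , g′) = h′ n hn (ω-transitive n hn m′ m k m′∈m) v
          in f′ ∘ f , g ∘ g′

  module Rep = Selector W (ω ∷ []) {R = _~_} ~-def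

  rep : S → S
  rep = Rep.select

  rep∈W : ∀ {s} → s ∈ W → rep s ∈ W
  rep∈W hs = proj₁ (Rep.select-spec hs ~-refl)

  ~-rep : ∀ {s} → s ∈ W → s ~ rep s
  ~-rep hs = proj₂ (Rep.select-spec hs ~-refl)

  rep-cong : ∀ {s t} → s ∈ W → s ~ t → rep s ≡ rep t
  rep-cong hs k = Rep.select-cong hs ~-refl
    λ z hz → mk⇔ (~-trans (~-sym k)) (~-trans k)

  private
    abstract
      rep-def : Class₂ (λ _ → Rep.selector) [] (λ s y → rep s ≡ y)
      rep-def = conv (λ _ → Rep.selector-⇔ _ _) (appᶜ 0 1 0)

  abstract
    F : S
    F = relation W W [] rep-def

    F⊆ : F ⊆ W ⊗ W
    F⊆ = relation⊆ W W [] rep-def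

    F-⇔ : ∀ {s y} → ⟨ s , y ⟩ ∈ F ⇔ (s ∈ W × y ∈ W × rep s ≡ y)
    F-⇔ = relation-⇔ W W [] rep-def _ _

  F-function : Function F W W
  F-function = F⊆ ,
    (λ s hs → rep s , rep∈W hs , from F-⇔ (hs , rep∈W hs , refl)) ,
    (λ s _ y _ y′ _ h h′ → trans (sym (proj₂ (proj₂ (to F-⇔ h)))) (proj₂ (proj₂ (to F-⇔ h′))))

  Big : S → Set
  Big A = ∃[ g ] Injection g Z A

  -- Here `B` is a counterexample to the Jónsson property of `A`. It is big again, so the failure
  -- can be iterated.
  Shrinks : S → S → Set
  Shrinks A B = B ⊆ A × Big B × ∃[ a ] (a ∈ A × ¬ Hits ω W F B a)

  private
    abstract
      identity-def : Class₂ σ₀ [] _≡_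
      identity-def = ⌜ eqᵈ 1 0 ⌝

  abstract
    Big-Z : Big Z
    Big-Z = relation Z Z [] identity-def ,
      (λ z hz → z , hz , from (relation-⇔ Z Z [] identity-def z z) (hz , hz , refl)) ,
      λ z _ z′ _ v _ h h′ → trans (value h) (sym (value h′))
      where
      value : ∀ {z v} → ⟨ z , v ⟩ ∈ relation Z Z [] identity-def → z ≡ v
      value h = proj₂ (proj₂ (to (relation-⇔ Z Z [] identity-def _ _) h))

  -- If no A works, dependent choice gives Aₙ ⊇ Aₙ₊₁ and αₙ ∈ Aₙ not hit from
  -- Aₙ₊₁.  The representative of the sequence α agrees with α at some index m,
  -- and is also the representative of a sequence in Aₘ₊₁: so αₘ is hit after all.
  module Contradiction (shrink : ∀ A → A ⊆ Z → Big A → ∃[ B ] Shrinks A B) where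

    private
      abstract
        shrinks-def : Class₂ σ₀ (ω ∷ W ∷ F ∷ Z ∷ []) Shrinks
        shrinks-def = ⌜ ⊆ᵈ 0 1 ⌝ ∧ᵖ ∃ᵖ ⌜ injectionᵈ 0 7 1 ⌝ ∧ᵖ
          ∃ᵖ (⌜ memᵈ 0 2 ⌝ ∧ᵖ (¬ᵖ ⌜ hitsᵈ 4 5 6 1 0 ⌝))

    module Next = Selector (𝒫 Z) (ω ∷ W ∷ F ∷ Z ∷ []) {R = Shrinks} shrinks-def

    abstract
      descent : Sequence Next.select Z
      descent = Recursion.sequence Next.select Next.selector Next.selector-⇔ Z

    open Sequence descent

    successor : ∀ {n A B} → n ∈ ω → ⟨ n , A ⟩ ∈ seq → ⟨ suc′ n , B ⟩ ∈ seq → B ≡ Next.select A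
    successor {n} hn h h′ = functional (suc′ n) _ _ h′ (next n _ hn h)

    shrinks-select : ∀ {A} → A ⊆ Z → Big A → Shrinks A (Next.select A)
    shrinks-select {A} A⊆ big with shrink A A⊆ big
    ... | B , B⊆ , h = proj₂ (Next.select-spec (from 𝒫-⇔ λ z → A⊆ z ∘ B⊆ z) (B⊆ , h))

    invariant : ∀ n → n ∈ ω → ∀ A → ⟨ n , A ⟩ ∈ seq → A ⊆ Z × Big A
    invariant = ω-induction {σ = σ₀} (seq ∷ Z ∷ [])
      (∀ᵖ (⌜ appᵈ 2 1 0 ⌝ ⇒ᵖ ⌜ ⊆ᵈ 0 3 ⌝ ∧ᵖ ∃ᵖ ⌜ injectionᵈ 0 4 1 ⌝))
      (λ A h → subst (λ A → A ⊆ Z × Big A) (functional ∅ Z A start h) ((λ _ → id) , Big-Z))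
      step
      where
      step : ∀ n → n ∈ ω → (∀ A → ⟨ n , A ⟩ ∈ seq → A ⊆ Z × Big A) →
             ∀ A → ⟨ suc′ n , A ⟩ ∈ seq → A ⊆ Z × Big A
      step n hn ih B h with total n hn
      ... | A , hA with ih A hA
      ... | A⊆ , big with refl ← successor hn hA h =
        let (B⊆ , big′ , _) = shrinks-select A⊆ big in (λ z → A⊆ z ∘ B⊆ z) , big′

    shrinks : ∀ {n A B} → n ∈ ω → ⟨ n , A ⟩ ∈ seq → ⟨ suc′ n , B ⟩ ∈ seq → Shrinks A B
    shrinks {n} {A} hn h h′ with invariant n hn A h
    ... | A⊆ , big with refl ← successor hn h h′ = shrinks-select A⊆ big

    -- The entries of `α` beyond `m` lie in the sets of index beyond `m`; this inclusion puts them
    -- all into the single set of index `suc′ m`.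
    decreasing : ∀ {m A} → ⟨ suc′ m , A ⟩ ∈ seq →
                 ∀ n → n ∈ ω → m ∈ n → ∀ B → ⟨ n , B ⟩ ∈ seq → B ⊆ A
    decreasing {m} {A} hA = ω-induction {σ = σ₀} (m ∷ seq ∷ A ∷ [])
      (⌜ memᵈ 1 0 ⌝ ⇒ᵖ ∀ᵖ (⌜ appᵈ 3 1 0 ⌝ ⇒ᵖ ⌜ ⊆ᵈ 0 4 ⌝))
      (λ h → ⊥-elim (∅-empty m h))
      step
      where
      step : ∀ n → n ∈ ω → (m ∈ n → ∀ B → ⟨ n , B ⟩ ∈ seq → B ⊆ A) →
             m ∈ suc′ n → ∀ B → ⟨ suc′ n , B ⟩ ∈ seq → B ⊆ A
      step n hn ih h B hB z hz with to suc′-⇔ h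
      ... | inj₂ refl = subst (z ∈_) (functional _ B A hB hA) hz
      ... | inj₁ m∈n with total n hn
      ... | B′ , hB′ = ih m∈n B′ hB′ z (proj₁ (shrinks hn hB′ hB) z hz)

    Escapes : S → S → Set
    Escapes n a = ∃[ A ] ∃[ n′ ] ∃[ B ] (n′ ≡ suc′ n × ⟨ n , A ⟩ ∈ seq × ⟨ n′ , B ⟩ ∈ seq
                    × a ∈ A × ¬ Hits ω W F B a)

    private
      abstract
        escapes-def : Class₂ σ₀ (ω ∷ W ∷ F ∷ seq ∷ []) Escapes
        escapes-def = ∃ᵖ (∃ᵖ (∃ᵖ (⌜ sucᵈ 1 4 ⌝ ∧ᵖ ⌜ appᵈ 9 4 2 ⌝ ∧ᵖ ⌜ appᵈ 9 1 0 ⌝ ∧ᵖ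
          ⌜ memᵈ 3 2 ⌝ ∧ᵖ (¬ᵖ ⌜ hitsᵈ 6 7 8 0 3 ⌝))))

    module Pick = Selector Z (ω ∷ W ∷ F ∷ seq ∷ []) {R = Escapes} escapes-def

    pick : S → S
    pick = Pick.select

    pick-spec : ∀ {n} → n ∈ ω → pick n ∈ Z × Escapes n (pick n)
    pick-spec {n} hn with total n hn | total (suc′ n) (suc′∈ω hn)
    ... | A , hA | B , hB with shrinks hn hA hB
    ... | _ , _ , a , ha , ¬hits =
      Pick.select-spec (proj₁ (invariant n hn A hA) a ha) (A , _ , B , refl , hA , hB , ha , ¬hits)

    pick∈ : ∀ {n A} → n ∈ ω → ⟨ n , A ⟩ ∈ seq → pick n ∈ A
    pick∈ {n} hn hA with proj₂ (pick-spec hn)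
    ... | A′ , _ , _ , _ , hA′ , _ , h , _ = subst (pick n ∈_) (functional n A′ _ hA′ hA) h

    pick-escapes : ∀ {n B} → n ∈ ω → ⟨ suc′ n , B ⟩ ∈ seq → ¬ Hits ω W F B (pick n)
    pick-escapes {n} hn hB with proj₂ (pick-spec hn)
    ... | _ , _ , B′ , refl , _ , hB′ , _ , h =
      subst (λ B → ¬ Hits ω W F B (pick n)) (functional _ B′ _ hB′ hB) h

    private
      abstract
        pick-def : Class₂ (λ _ → Pick.selector) [] (λ n v → pick n ≡ v)
        pick-def = conv (λ _ → Pick.selector-⇔ _ _) (appᶜ 0 1 0)

    abstract
      α : S
      α = relation ω Z [] pick-def

      α⊆ : α ⊆ ω ⊗ Z
      α⊆ = relation⊆ ω Z [] pick-def

      α-⇔ : ∀ {n v} → ⟨ n , v ⟩ ∈ α ⇔ (n ∈ ω × v ∈ Z × pick n ≡ v)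
      α-⇔ = relation-⇔ ω Z [] pick-def _ _

    pick∈α : ∀ {n} → n ∈ ω → ⟨ n , pick n ⟩ ∈ α
    pick∈α hn = from α-⇔ (hn , proj₁ (pick-spec hn) , refl)

    α∈W : α ∈ W
    α∈W = from W-⇔ (α⊆ ,
      (λ n hn → pick n , proj₁ (pick-spec hn) , pick∈α hn) ,
      λ _ _ _ _ _ _ h h′ → trans (sym (proj₂ (proj₂ (to α-⇔ h)))) (proj₂ (proj₂ (to α-⇔ h′))))

    module Tail (m : S) (m∈ω : m ∈ ω) where

      private
        -- Beyond `m` the sequence `β` follows `α`; up to `m` it is padded with the constant
        -- `pick (suc′ m)`, which already lies in the set of index `suc′ m`. So `β` is equivalent to
        -- `α` and runs entirely inside that set.
        TailEntry : S → S → Set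
        TailEntry n v = (m ∈ n × ⟨ n , v ⟩ ∈ α) ⊎ (¬ m ∈ n × pick (suc′ m) ≡ v)

        abstract
          tail-def : Class₂ σ₀ (m ∷ α ∷ pick (suc′ m) ∷ []) TailEntry
          tail-def = (⌜ memᵈ 3 1 ⌝ ∧ᵖ ⌜ appᵈ 4 1 0 ⌝) ∨ᵖ ((¬ᵖ ⌜ memᵈ 3 1 ⌝) ∧ᵖ ⌜ eqᵈ 5 0 ⌝)

      abstract
        β : S
        β = relation ω Z (m ∷ α ∷ pick (suc′ m) ∷ []) {R = TailEntry} tail-def

        β⊆ : β ⊆ ω ⊗ Z
        β⊆ = relation⊆ ω Z (m ∷ α ∷ pick (suc′ m) ∷ []) {R = TailEntry} tail-def

        β-⇔ : ∀ {n v} → ⟨ n , v ⟩ ∈ β ⇔ (n ∈ ω × v ∈ Z × TailEntry n v)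
        β-⇔ = relation-⇔ ω Z (m ∷ α ∷ pick (suc′ m) ∷ []) {R = TailEntry} tail-def _ _

      β-total : ∀ {B} → B ⊆ Z → ⟨ suc′ m , B ⟩ ∈ seq → Total β ω B
      β-total {B} B⊆Z hB n hn with em {m ∈ n}
      ... | no m∉n = pick (suc′ m) , in-B ,
              from β-⇔ (hn , B⊆Z _ in-B , inj₂ (m∉n , refl))
        where
        in-B : pick (suc′ m) ∈ B
        in-B = pick∈ (suc′∈ω m∈ω) hB
      ... | yes m∈n with total n hn
      ... | A , hA = pick n , decreasing hB n hn m∈n A hA _ (pick∈ hn hA) ,
              from β-⇔ (hn , proj₁ (pick-spec hn) , inj₁ (m∈n , pick∈α hn))

      β∈W : ∀ {B} → B ⊆ Z → ⟨ suc′ m , B ⟩ ∈ seq → β ∈ W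
      β∈W B⊆Z hB = from W-⇔ (β⊆ ,
        (λ n hn → case β-total B⊆Z hB n hn of λ (v , hv , h) → v , B⊆Z v hv , h) ,
        λ n _ v _ v′ _ h h′ → unique (proj₂ (proj₂ (to β-⇔ h))) (proj₂ (proj₂ (to β-⇔ h′))))
        where
        unique : ∀ {n v v′} → TailEntry n v → TailEntry n v′ → v ≡ v′
        unique (inj₁ (_ , h)) (inj₁ (_ , h′)) =
          trans (sym (proj₂ (proj₂ (to α-⇔ h)))) (proj₂ (proj₂ (to α-⇔ h′)))
        unique (inj₁ (h , _)) (inj₂ (¬h , _)) = ⊥-elim (¬h h)
        unique (inj₂ (¬h , _)) (inj₁ (h , _)) = ⊥-elim (¬h h)
        unique (inj₂ (_ , q)) (inj₂ (_ , q′)) = trans (sym q) q′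

      α~β : α ~ β
      α~β = m , m∈ω , λ n hn m∈n v →
        (λ h → from β-⇔ (hn , proj₁ (proj₂ (to α-⇔ h)) , inj₁ (m∈n , h))) ,
        λ h → [ proj₂ , (λ (m∉n , _) → ⊥-elim (m∉n m∈n)) ]′ (proj₂ (proj₂ (to β-⇔ h)))

    contradiction : ⊥
    contradiction with ~-rep α∈W
    -- `same` gives agreement only strictly after `m₀`, so the index used is its successor `m`, and
    -- `B` has index `suc′ m`. Then `pick m` is hit from `B` through `β`, against `pick-escapes`.
    ... | m₀ , hm₀ , same with total (suc′ (suc′ m₀)) (suc′∈ω (suc′∈ω hm₀))
    ... | B , hB = pick-escapes hm hB
          (β , β∈W B⊆Z hB , rep α , rep∈W α∈W ,
           from F-⇔ (β∈W B⊆Z hB , rep∈W α∈W , sym (rep-cong α∈W α~β)) ,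
           (m , hm , proj₁ (same m hm ∈-suc′ (pick m)) (pick∈α hm)) ,
           β-total B⊆Z hB)
      where
      m : S
      m = suc′ m₀
      hm : m ∈ ω
      hm = suc′∈ω hm₀
      B⊆Z : B ⊆ Z
      B⊆Z = proj₁ (invariant _ (suc′∈ω hm) B hB)
      open Tail m hm

  jónsson : ∃[ A ] (A ⊆ Z × Big A × Jónsson ω W F Z A)
  jónsson with em {∃[ A ] (A ⊆ Z × Big A × Jónsson ω W F Z A)}
  ... | yes h = h
  ... | no ¬h = ⊥-elim (Contradiction.contradiction shrink)
    where
    shrink : ∀ A → A ⊆ Z → Big A → ∃[ B ] Shrinks A B
    shrink A A⊆ big with em {∃[ B ] Shrinks A B}
    ... | yes h = h
    ... | no ¬shrinks = ⊥-elim (¬h (A , A⊆ , big , λ B g hg B⊆ a ha → hits B g hg B⊆ a ha))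
      where
      hits : Jónsson ω W F Z A
      hits B g hg B⊆ a ha with em {Hits ω W F B a}
      ... | yes h = h
      ... | no h  = ⊥-elim (¬shrinks (B , B⊆ , (g , hg) , a , ha , h))

-- What a Σ₁-elementary embedding preserves.

module Embedding (em : ExcludedMiddle 0ℓ) (M : Structure) (gbc : GBC⁻ᶠ M)
                 (J : Structure.C M) (embedding : NontrivialΣ₁Embedding M J) where
  open SetTheory em M gbc
  open NaturalNumbers em M gbc
  open Functions em M gbc
  private
    module J = NontrivialΣ₁Embedding embedding

  j : S → S
  j x = proj₁ (J.total x)

  private
    σJ : ℕ → C
    σJ _ = J

  j-graph : ∀ {x y} → ⟨ x , y ⟩ ∈ᶜ J ⇔ j x ≡ y
  j-graph {x} {y} = mk⇔ (λ h → J.functional x _ y (proj₂ (J.total x)) (from RelC-⇔ h))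
                        (λ { refl → to RelC-⇔ (proj₂ (J.total x)) })

  jᵖ : ∀ {Γ : Set} {e : Γ → ℕ → S} i k → Def Predicative σJ e (λ γ → j (e γ i) ≡ e γ k)
  jᵖ i k = conv (λ _ → j-graph) (appᶜ 0 i k)

  elementary : ∀ φ → Σ₁ φ → ∀ ρ → Sat M φ ρ σJ ⇔ Sat M φ (j ∘ ρ) σJ
  elementary φ s ρ = J.elementary φ s ρ (j ∘ ρ) σJ λ n → proj₂ (J.total (ρ n))

  abstract
    elementary-Δ₀ : ∀ {P : (ℕ → S) → Set} → Def Δ₀ σJ id P → ∀ ρ → P ρ ⇔ P (j ∘ ρ)
    elementary-Δ₀ (def φ k s) ρ = s (j ∘ ρ) ⇔-∘ (elementary φ (s-Δ₀ k) ρ ⇔-∘ ⇔-sym (s ρ))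

  -- `Σ₁` is not closed under `_⇒f_`, so the negation is moved inwards past the leading universal
  -- quantifiers, each of which turns existential by excluded middle.
  negation : ∀ {φ} → Π₁ φ → ∃[ ψ ] (Σ₁ ψ × (∀ ρ → Sat M ψ ρ σJ ⇔ (¬ Sat M φ ρ σJ)))
  negation (π-Δ₀ {φ} d) = φ ⇒f falsum , s-Δ₀ (d-⇒ d d-⊥) , λ ρ → mk⇔ id id
  negation (π-∀ {φ} p) with negation p
  ... | ψ , s , h = ∃s ψ , s-∃ s , λ ρ →
    mk⇔ (λ (a , k) l → to (h (ext a ρ)) k (l a))
        (λ k → case em {∃[ a ] Sat M ψ (ext a ρ) σJ} of λ
          { (yes l) → l
          ; (no ¬l) → ⊥-elim (k λ a → case em {Sat M φ (ext a ρ) σJ} of λ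
              { (yes l) → l ; (no ¬m) → ⊥-elim (¬l (a , from (h (ext a ρ)) ¬m)) }) })

  abstract
    -- If the formula failed at `j ∘ ρ`, its Σ₁ negation would hold there and elementarity would
    -- bring it back to `ρ`.
    elementary-Π₁ : ∀ {P : (ℕ → S) → Set} → Def Π₁ σJ id P → ∀ ρ → P ρ → P (j ∘ ρ)
    elementary-Π₁ (def φ k s) ρ p with negation k | em {Sat M φ (j ∘ ρ) σJ}
    ... | _         | yes q = to (s (j ∘ ρ)) q
    ... | ψ , t , h | no ¬q = ⊥-elim (to (h ρ)
            (from (elementary ψ t ρ) (from (h (j ∘ ρ)) ¬q)) (from (s ρ) p))

  j-∈ : ∀ {x y} → x ∈ y ⇔ j x ∈ j y
  j-∈ {x} {y} = elementary-Δ₀ (memᵈ 0 1) (env (x ∷ y ∷ []))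

  j-injective : ∀ {x y} → j x ≡ j y → x ≡ y
  j-injective {x} {y} = from (elementary-Δ₀ (eqᵈ 0 1) (env (x ∷ y ∷ [])))

  j-⊆ : ∀ {x y} → x ⊆ y → j x ⊆ j y
  j-⊆ {x} {y} = to (elementary-Δ₀ (⊆ᵈ 0 1) (env (x ∷ y ∷ [])))

  j-⟨⟩ : ∀ {x y} → j ⟨ x , y ⟩ ≡ ⟨ j x , j y ⟩
  j-⟨⟩ {x} {y} = to (elementary-Δ₀ (opᵈ 0 1 2) (env (⟨ x , y ⟩ ∷ x ∷ y ∷ []))) refl

  j-app : ∀ {f x y} → ⟨ x , y ⟩ ∈ f → ⟨ j x , j y ⟩ ∈ j f
  j-app {f} h = subst (_∈ j f) j-⟨⟩ (to j-∈ h)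

  -- A bounded existential true at the images is true at the originals. The `x` found need not be
  -- given with `j x ≡ w`; `jZ⊆image` obtains such an equation from injectivity.
  j-preimage : ∀ {f a y w} → w ∈ j a → ⟨ w , j y ⟩ ∈ j f → ∃[ x ] (x ∈ a × ⟨ x , y ⟩ ∈ f)
  j-preimage {f} {a} {y} {w} hw k =
    from (elementary-Δ₀ (∃∈ᵈ 0 (appᵈ 2 0 3)) (env (a ∷ f ∷ y ∷ []))) (w , hw , k)

  j-function : ∀ {f a b} → Function f a b → Function (j f) (j a) (j b)
  j-function {f} {a} {b} = to (elementary-Δ₀ (functionᵈ 0 1 2) (env (f ∷ a ∷ b ∷ [])))

  j-injection : ∀ {f a b} → Injection f a b → Injection (j f) (j a) (j b)
  j-injection {f} {a} {b} = to (elementary-Δ₀ (injectionᵈ 0 1 2) (env (f ∷ a ∷ b ∷ [])))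

  -- Being contained in every inductive set is Π₁, so `j ω` lies inside `ω`; being inductive is Δ₀,
  -- so `ω` lies inside `j ω`.
  j-ω : j ω ≡ ω
  j-ω = ⊆-antisym
    (elementary-Π₁ (∀ᵖⁱ (ΔΠ (inductiveᵈ 0 ⇒ᵈ ⊆ᵈ 1 0))) (env (ω ∷ [])) ω-least ω ω-inductive)
    (ω-least (j ω) (to (elementary-Δ₀ (inductiveᵈ 0) (env (ω ∷ []))) ω-inductive))

  -- `J` is a class, so a formula may mention it and induction applies to the fixed points of `j`.
  j-fixes-ω : ∀ n → n ∈ ω → j n ≡ n
  j-fixes-ω = ω-induction [] (jᵖ 0 0)
    (to (elementary-Δ₀ (∅ᵈ 0) (env (∅ ∷ []))) refl)
    λ n _ q → trans (to (elementary-Δ₀ (sucᵈ 0 1) (env (suc′ n ∷ n ∷ []))) refl) (cong suc′ q)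

  -- A transitive set `Z` containing `x` with `j Z ⊆ Z`.

  module Closure (x : S) where

    step : S → S
    step y = (y ∪ ⋃ y) ∪ j y

    private
      InStep : S → S → Set
      InStep y z = (z ∈ y ⊎ ∃[ w ] (w ∈ y × z ∈ w)) ⊎ ∃[ w ] (j y ≡ w × z ∈ w)

      in-step : ∀ {y z} → z ∈ step y ⇔ InStep y z
      in-step = mk⇔
        (λ h → [ inj₁ ∘ [ inj₁ , inj₂ ∘ to ⋃-⇔ ]′ ∘ to ∪-⇔ , (λ k → inj₂ (_ , refl , k)) ]′ (to ∪-⇔ h))
        [ from ∪-⇔ ∘ inj₁ ∘ from ∪-⇔ ∘ [ inj₁ , inj₂ ∘ from ⋃-⇔ ]′ ,
          (λ { (_ , refl , k) → from ∪-⇔ (inj₂ k) }) ]′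

      step-class : ∃[ X ] (∀ y y′ → ⟨ y , y′ ⟩ ∈ᶜ X ⇔
                     (∀ z → (z ∈ y′ → InStep y z) × (InStep y z → z ∈ y′)))
      step-class = class₂ {σ = σJ} [] (∀ᵖ ((⌜ memᵈ 0 1 ⌝ ⇒ᵖ in-stepᵖ) ∧ᵖ (in-stepᵖ ⇒ᵖ ⌜ memᵈ 0 1 ⌝)))
        where
        in-stepᵖ : ∀ {Γ : Set} {e : Γ → ℕ → S} → Def Predicative σJ e (λ γ → InStep (e γ 2) (e γ 0))
        in-stepᵖ = (⌜ memᵈ 0 2 ⌝ ∨ᵖ ∃ᵖ (⌜ memᵈ 0 3 ⌝ ∧ᵖ ⌜ memᵈ 1 0 ⌝)) ∨ᵖ
                   ∃ᵖ (jᵖ 3 0 ∧ᵖ ⌜ memᵈ 1 0 ⌝)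

      step-⇔ : ∀ y y′ → ⟨ y , y′ ⟩ ∈ᶜ proj₁ step-class ⇔ step y ≡ y′
      step-⇔ y y′ = mk⇔
        (λ h → let k = to (proj₂ step-class y y′) h in
          ⊆-antisym (λ z → proj₂ (k z) ∘ to in-step) (λ z → from in-step ∘ proj₁ (k z)))
        (λ { refl → from (proj₂ step-class y y′) λ z → to in-step , from in-step })

    abstract
      iterates : Sequence step (pr x x)
      iterates = Recursion.sequence step (proj₁ step-class) step-⇔ (pr x x)

    open Sequence iterates

    abstract
      Z : S
      Z = ⋃ values

      Z-⇔ : ∀ {z} → z ∈ Z ⇔ (∃[ y ] (y ∈ values × z ∈ y))
      Z-⇔ = ⋃-⇔

    value∈ : ∀ {n y} → ⟨ n , y ⟩ ∈ seq → y ∈ values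
    value∈ h with seq⊆ _ h
    ... | _ , _ , _ , hv , q with refl , refl ← ⟨⟩-inj q = hv

    step⊆Z : ∀ {y} → y ∈ values → step y ⊆ Z
    step⊆Z {y} hy z hz with surjective y hy
    ... | n , hn , h = from Z-⇔ (step y , value∈ (next n y hn h) , hz)

    x∈Z : x ∈ Z
    x∈Z = from Z-⇔ (pr x x , value∈ start , ∈prˡ)

    Z-transitive : Transitive Z
    Z-transitive z w hw hz with to Z-⇔ hw
    ... | y , hy , w∈y = step⊆Z hy z (from in-step (inj₁ (inj₂ (w , w∈y , hz))))

    seq-function : Function seq ω values
    seq-function = seq⊆ , (λ n hn → case total n hn of λ (y , h) → y , value∈ h , h) ,
      λ n _ y _ y′ _ → functional n y y′

    -- The half of the construction of `Z` that `jZ⊆Z` relies on, as a Δ₀ condition on four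
    -- parameters to which `j` can be applied.
    Covered : (Z R ω f : S) → Set
    Covered Z R ω f = ∀ z → z ∈ Z → ∃[ y ] (y ∈ R × z ∈ y × ∃[ n ] (n ∈ ω × ⟨ n , y ⟩ ∈ f))

    covered : Covered (j Z) (j values) (j ω) (j seq)
    covered = to (elementary-Δ₀
      (∀∈ᵈ 0 (∃∈ᵈ 2 (memᵈ 1 0 ∧ᵈ ∃∈ᵈ 4 (appᵈ 6 0 1)))) (env (Z ∷ values ∷ ω ∷ seq ∷ [])))
      λ z hz → case to Z-⇔ hz of λ (y , hy , z∈y) → y , hy , z∈y , surjective y hy

    -- An element of `j Z` lies in a term of `j seq` whose index is in `j ω`, that is in `ω`, and so
    -- is fixed by `j`. That term is `j y₀` for the term `y₀` of `seq` at the same index, and `step`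
    -- puts `j y₀` into `Z`.
    jZ⊆Z : j Z ⊆ Z
    jZ⊆Z z hz with covered z hz
    ... | y , hy , z∈y , n , hn , h with total n (subst (n ∈_) j-ω hn)
    ... | y₀ , h₀ = step⊆Z (value∈ h₀) z (from in-step (inj₂ (j y₀ , refl , subst (z ∈_) y≡jy₀ z∈y)))
      where
      h₀′ : ⟨ n , j y₀ ⟩ ∈ j seq
      h₀′ = subst (λ m → ⟨ m , j y₀ ⟩ ∈ j seq) (j-fixes-ω n (subst (n ∈_) j-ω hn)) (j-app h₀)
      y≡jy₀ : y ≡ j y₀
      y≡jy₀ = proj₂ (proj₂ (j-function seq-function)) n hn y hy (j y₀) (to j-∈ (value∈ h₀)) h h₀′

  -- Every element of `j Z` is `j` of an element of `Z`.

  module Image (Z : S) (jZ⊆Z : j Z ⊆ Z) where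
    open JónssonFunction em M gbc Z hiding (jónsson)

    abstract
      jónsson : ∃[ A ] (A ⊆ Z × Big A × Jónsson ω W F Z A)
      jónsson = JónssonFunction.jónsson em M gbc Z

    A h : S
    A = proj₁ jónsson
    h = proj₁ (proj₁ (proj₂ (proj₂ jónsson)))

    A⊆Z : A ⊆ Z
    A⊆Z = proj₁ (proj₂ jónsson)

    h-injection : Injection h Z A
    h-injection = proj₂ (proj₁ (proj₂ (proj₂ jónsson)))

    j-jónsson : Jónsson (j ω) (j W) (j F) (j Z) (j A)
    j-jónsson = elementary-Π₁
      (∀ᵖⁱ (∀ᵖⁱ (ΔΠ (injectionᵈ 0 5 1 ⇒ᵈ ⊆ᵈ 1 6 ⇒ᵈ ∀∈ᵈ 6 (hitsᵈ 3 4 5 2 0)))))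
      (env (ω ∷ W ∷ F ∷ Z ∷ A ∷ [])) (proj₂ (proj₂ (proj₂ jónsson)))

    jW-function : ∀ {s} → s ∈ j W → Function s ω (j Z)
    jW-function {s} hs = subst (λ w → Function s w (j Z)) j-ω
      (to (elementary-Δ₀ (∀∈ᵈ 0 (functionᵈ 0 2 3)) (env (W ∷ ω ∷ Z ∷ []))) (λ s → to W-⇔) s hs)

    private
      image : ∃[ B ] (∀ b → b ∈ B ⇔ (b ∈ j A × ∃[ v ] (v ∈ A × j v ≡ b)))
      image = separate {σ = σJ} (j A) (A ∷ []) (∃ᵖ (⌜ memᵈ 0 2 ⌝ ∧ᵖ jᵖ 0 1))

    abstract
      B : S
      B = proj₁ image

      B-⇔ : ∀ {b} → b ∈ B ⇔ (b ∈ j A × ∃[ v ] (v ∈ A × j v ≡ b))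
      B-⇔ = proj₂ image _

    j∈B : ∀ {v} → v ∈ A → j v ∈ B
    j∈B hv = from B-⇔ (to j-∈ hv , _ , hv , refl)

    private
      JH : S → S → Set
      JH z b = ∃[ v ] (v ∈ A × ⟨ z , v ⟩ ∈ h × j v ≡ b)

      abstract
        JH-def : Class₂ σJ (A ∷ h ∷ []) JH
        JH-def = ∃ᵖ (⌜ memᵈ 0 4 ⌝ ∧ᵖ ⌜ appᵈ 5 2 0 ⌝ ∧ᵖ jᵖ 0 1)

    j∘h : S
    j∘h = relation (j Z) B (A ∷ h ∷ []) {R = JH} JH-def

    j∘h-⇔ : ∀ {z b} → ⟨ z , b ⟩ ∈ j∘h ⇔ (z ∈ j Z × b ∈ B × JH z b)
    j∘h-⇔ = relation-⇔ (j Z) B (A ∷ h ∷ []) {R = JH} JH-def _ _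

    -- Elements of `j Z` are in the domain of `h` because `j Z ⊆ Z`; injectivity of `j` reduces a
    -- shared value to one shared under `h`.
    j∘h-injection : Injection j∘h (j Z) B
    j∘h-injection =
      (λ z hz → case proj₁ h-injection z (jZ⊆Z z hz) of λ (v , hv , k) →
        j v , j∈B hv , from j∘h-⇔ (hz , j∈B hv , v , hv , k , refl)) ,
      λ z hz z′ hz′ b _ k k′ → unique hz hz′ (proj₂ (proj₂ (to j∘h-⇔ k))) (proj₂ (proj₂ (to j∘h-⇔ k′)))
      where
      unique : ∀ {z z′ b} → z ∈ j Z → z′ ∈ j Z → JH z b → JH z′ b → z ≡ z′
      unique hz hz′ (v , hv , k , q) (v′ , _ , k′ , q′) with refl ← j-injective (trans q (sym q′)) =
        proj₂ h-injection _ (jZ⊆Z _ hz) _ (jZ⊆Z _ hz′) v hv k k′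

    -- A sequence in B = j[A] is j of the sequence of preimages, as j fixes ω
    -- pointwise.
    module Lift (s : S) (s∈jW : s ∈ j W) (s-total : Total s ω B) where

      private
        abstract
          lift-def : Class₂ σJ (s ∷ []) (λ n v → ∃[ b ] (j v ≡ b × ⟨ n , b ⟩ ∈ s))
          lift-def = ∃ᵖ (jᵖ 1 0 ∧ᵖ ⌜ appᵈ 4 2 0 ⌝)

      abstract
        s′ : S
        s′ = relation ω Z (s ∷ []) lift-def

        s′⊆ : s′ ⊆ ω ⊗ Z
        s′⊆ = relation⊆ ω Z (s ∷ []) lift-def

        s′-⇔ : ∀ {n v} → ⟨ n , v ⟩ ∈ s′ ⇔ (n ∈ ω × v ∈ Z × ⟨ n , j v ⟩ ∈ s)
        s′-⇔ = mk⇔ (λ { (hn , hv , _ , refl , k) → hn , hv , k })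
                   (λ (hn , hv , k) → hn , hv , _ , refl , k)
               ⇔-∘ relation-⇔ ω Z (s ∷ []) lift-def _ _

      s-function : Function s ω (j Z)
      s-function = jW-function s∈jW

      s′-total : ∀ n → n ∈ ω → ∃[ v ] (v ∈ Z × ⟨ n , v ⟩ ∈ s′)
      s′-total n hn with s-total n hn
      ... | b , hb , k with to B-⇔ hb
      ... | _ , v , hv , refl = v , A⊆Z v hv , from s′-⇔ (hn , A⊆Z v hv , k)

      s′-function : Function s′ ω Z
      s′-function = s′⊆ , s′-total , λ n hn v hv v′ hv′ k k′ → j-injective
        (proj₂ (proj₂ s-function) n hn (j v) (to j-∈ hv) (j v′) (to j-∈ hv′)
          (proj₂ (proj₂ (to s′-⇔ k))) (proj₂ (proj₂ (to s′-⇔ k′))))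

      js′-app : ∀ {n v} → n ∈ ω → ⟨ n , v ⟩ ∈ s′ → ⟨ n , j v ⟩ ∈ j s′
      js′-app {n} {v} hn k = subst (λ m → ⟨ m , j v ⟩ ∈ j s′) (j-fixes-ω n hn) (j-app k)

      -- Both are functions on `ω`, and at each `n` both have the value `j v` for the `v` that `s′`
      -- assigns to `n`.
      js′≡s : j s′ ≡ s
      js′≡s = ⊆-antisym left right
        where
        js′-function : Function (j s′) ω (j Z)
        js′-function = subst (λ w → Function (j s′) w (j Z)) j-ω (j-function s′-function)
        left : j s′ ⊆ s
        left p hp with proj₁ js′-function p hp
        ... | n , hn , b , hb , refl with s′-total n hn
        ... | v , hv , k with refl ← proj₂ (proj₂ js′-function) n hn b hb (j v) (to j-∈ hv) hp (js′-app hn k)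
          = proj₂ (proj₂ (to s′-⇔ k))
        right : s ⊆ j s′
        right p hp with proj₁ s-function p hp
        ... | n , hn , b , hb , refl with s′-total n hn
        ... | v , hv , k with refl ← proj₂ (proj₂ s-function) n hn b hb (j v) (to j-∈ hv) hp (proj₂ (proj₂ (to s′-⇔ k)))
          = js′-app hn k

    jA⊆image : ∀ a → a ∈ j A → ∃[ v ] (v ∈ Z × a ≡ j v)
    jA⊆image a ha with j-jónsson B j∘h j∘h-injection (λ b → proj₁ ∘ to B-⇔) a ha
    ... | s , s∈jW , y , y∈jW , sy , (n , hn , na) , s-total =
      value (proj₁ (proj₂ F-function) s′ s′∈W)
      where
      open Lift s s∈jW (subst (λ w → Total s w B) j-ω s-total)
      n∈ω : n ∈ ω
      n∈ω = subst (n ∈_) j-ω hn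
      s′∈W : s′ ∈ W
      s′∈W = from W-⇔ s′-function
      value : ∃[ y′ ] (y′ ∈ W × ⟨ s′ , y′ ⟩ ∈ F) → ∃[ v ] (v ∈ Z × a ≡ j v)
      -- `j F` sends `s` to `y` and `j s′` to `j y′`; as `j s′ ≡ s`, the two values coincide.
      value (y′ , y′∈W , k)
        with refl ← proj₂ (proj₂ (j-function F-function)) s s∈jW y y∈jW (j y′) (to j-∈ y′∈W) sy
                      (subst (λ u → ⟨ u , j y′ ⟩ ∈ j F) js′≡s (j-app k))
        with proj₁ (proj₂ (to W-⇔ y′∈W)) n n∈ω
      -- Both `a` and `j v` are values of `j y′` at `n`, which `j` fixes.
      ... | v , hv , l = v , hv ,
        proj₂ (proj₂ (jW-function y∈jW)) n n∈ω a (j-⊆ A⊆Z a ha) (j v) (to j-∈ hv) na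
          (subst (λ m → ⟨ m , j v ⟩ ∈ j y′) (j-fixes-ω n n∈ω) (j-app l))

    -- The conclusion passes from `j A` back to `j Z` along `j h`: the value of `w` is some `j v`,
    -- elementarity gives `u` with value `v` under `h`, and then `w` and `j u` share the value `j v`
    -- under the injection `j h`.
    jZ⊆image : ∀ w → w ∈ j Z → ∃[ u ] (u ∈ Z × w ≡ j u)
    jZ⊆image w hw = let (b , hb , wb) = proj₁ (j-injection h-injection) w hw in
      pull-back b hb wb (jA⊆image b hb)
      where
      pull-back : ∀ b → b ∈ j A → ⟨ w , b ⟩ ∈ j h → ∃[ v ] (v ∈ Z × b ≡ j v) →
                  ∃[ u ] (u ∈ Z × w ≡ j u)
      pull-back _ hb wb (v , hv , refl) = let (u , hu , uv) = j-preimage hw wb in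
        u , hu , proj₂ (j-injection h-injection) w hw (j u) (to j-∈ hu) (j v) hb wb (j-app uv)

  -- The isomorphism between transitive closures.

  module Isomorphism (x : S) where
    open Closure x
    open Image Z jZ⊆Z using (jZ⊆image)

    -- Describes TC({x}) without naming the singleton. The first two clauses are Δ₀ and leastness is
    -- Π₁, so all of them pass to `j t` and `j x`.
    IsClosure : S → S → Set
    IsClosure t x = x ∈ t × Transitive t × (∀ T → Transitive T → x ∈ T → t ⊆ T)

    transitiveᵈ : ∀ {Γ : Set} {e : Γ → ℕ → S} i → Def Δ₀ σJ e (λ γ → Transitive (e γ i))
    transitiveᵈ i = conv (λ γ → mk⇔ (λ h z w hw hz → h w hw z hz) (λ h w hw z hz → h z w hw hz))
      (∀∈ᵈ i (∀∈ᵈ 0 (memᵈ 0 (suc (suc i)))))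

    private
      closure : ∃[ t ] (∀ z → z ∈ t ⇔ (z ∈ Z × (∀ T → Transitive T → x ∈ T → z ∈ T)))
      -- `Z` is transitive with `x` as an element, so it contains the closure and separation
      -- suffices.
      closure = separate {σ = σJ} Z (x ∷ []) (∀ᵖ (⌜ transitiveᵈ 0 ⌝ ⇒ᵖ ⌜ memᵈ 2 0 ⌝ ⇒ᵖ ⌜ memᵈ 1 0 ⌝))

    abstract
      t : S
      t = proj₁ closure

      t-⇔ : ∀ {z} → z ∈ t ⇔ (z ∈ Z × (∀ T → Transitive T → x ∈ T → z ∈ T))
      t-⇔ = proj₂ closure _

    t-closure : IsClosure t x
    t-closure = from t-⇔ (x∈Z , λ _ _ → id) ,
      (λ z w hw hz → let (w∈Z , k) = to t-⇔ hw in
        from t-⇔ (Z-transitive z w w∈Z hz , λ T tr hx → tr z w (k T tr hx) hz)) ,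
      λ T tr hx z hz → proj₂ (to t-⇔ hz) T tr hx

    jt-closure : IsClosure (j t) (j x)
    jt-closure with t-closure
    ... | x∈t , tr , least = to j-∈ x∈t , to (elementary-Δ₀ (transitiveᵈ 0) (env (t ∷ []))) tr ,
      elementary-Π₁ (∀ᵖⁱ (ΔΠ (transitiveᵈ 0 ⇒ᵈ memᵈ 2 0 ⇒ᵈ ⊆ᵈ 1 0))) (env (t ∷ x ∷ [])) least

    closure⇒TC : ∀ {t x} → IsClosure t x → IsTCsingleton t x
    closure⇒TC {t} {x} (hx , tr , least) = pr x x , (λ _ → pr-⇔) ,
      (λ z hz → subst (_∈ t) (sym (∈sg hz)) hx) , tr , λ T trT h → least T trT (h x ∈prˡ)

    private
      abstract
        j-def : Class₂ σJ [] (λ z w → j z ≡ w)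
        j-def = jᵖ 1 0

    f : S
    f = relation t (j t) [] j-def

    f-⇔ : ∀ {z w} → RelS f z w ⇔ (z ∈ t × w ∈ j t × j z ≡ w)
    f-⇔ = relation-⇔ t (j t) [] j-def _ _ ⇔-∘ RelS-⇔

    j-f : ∀ {z} → z ∈ t → RelS f z (j z)
    j-f hz = from f-⇔ (hz , to j-∈ hz , refl)

    f-value : ∀ {z w} → RelS f z w → j z ≡ w
    f-value = proj₂ ∘ proj₂ ∘ to f-⇔

    f-iso : IsIso f t (j t)
    f-iso =
      (λ p hp → case relation⊆ t (j t) [] j-def p hp of λ { (a , ha , b , hb , refl) →
        a , b , IsOPair-⟨⟩ , ha , hb }) ,
      (λ a ha → j a , j-f ha) ,
      (λ a b b′ h h′ → trans (sym (f-value h)) (f-value h′)) ,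
      (λ a a′ b h h′ → j-injective (trans (f-value h) (sym (f-value h′)))) ,
      onto ,
      λ a a′ b b′ h h′ → subst₂ (λ u v → a ∈ a′ ⇔ u ∈ v) (f-value h) (f-value h′) j-∈
      where
      -- An element of `j t` lies in `j Z`, so it is `j u` with `u` in `Z`; elementarity reflects
      -- `j u ∈ j t` to `u ∈ t`.
      onto : ∀ b → b ∈ j t → ∃[ a ] RelS f a b
      onto b hb = from-image hb (jZ⊆image b (j-⊆ (λ z → proj₁ ∘ to t-⇔) b hb))
        where
        from-image : ∀ {b} → b ∈ j t → ∃[ u ] (u ∈ Z × b ≡ j u) → ∃[ a ] RelS f a b
        from-image hb (u , _ , refl) = u , j-f (from j-∈ hb)

    isomorphic : Isomorphic x (j x)
    isomorphic = t , j t , f , closure⇒TC t-closure , closure⇒TC jt-closure , f-iso ,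
      j-f (proj₁ t-closure)

theorem13 : ExcludedMiddle 0ℓ → (M : Structure) → GBC⁻ᶠ M → IE M
    → ¬ (∃[ J ] NontrivialΣ₁Embedding M J)
theorem13 em M gbc ie (J , embedding) with NontrivialΣ₁Embedding.nontrivial embedding
... | x , y , x↦y , x≢y = x≢y (trans (ie x (j x) (Isomorphism.isomorphic x)) jx≡y)
  where
  open Embedding em M gbc J embedding
  jx≡y : j x ≡ y
  jx≡y = NontrivialΣ₁Embedding.functional embedding x (j x) y
           (proj₂ (NontrivialΣ₁Embedding.total embedding x)) x↦y
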